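{- Let $p$ be a prime, $d,t$ positive integers, $W=\mathbb{F}_p^d$, $U=\mathbb{F}_p^t$, and $V=\mathbb{F}_p^{d+t}=W\oplus U$. Let $g$ be a complete mapping of $U$ of cycle type $x_1^{k_1}\cdots x_{p^t}^{k_{p^t}}$, and for $\ell=1,\ldots,p^t$ enumerate its cycles of length $\ell$ as $\zeta_{\ell,i}=(u_{\ell,i,0},u_{\ell,i,1},\ldots,u_{\ell,i,\ell-1})$, $i=1,\ldots,k_\ell$ (so $g(u_{\ell,i,j})=u_{\ell,i,(j+1)\bmod \ell}$). For each such $\ell,i$ and $j=0,\ldots,\ell-1$ choose $M_{\ell,i,j}\in\operatorname{CGL}_d(p)$, and choose $w_{\ell,i}\in W$; put $\gamma_{\ell,i}=\operatorname{CT}(\lambda(M_{\ell,i,0}M_{\ell,i,1}\cdots M_{\ell,i,\ell-1},w_{\ell,i}))$. For $u=u_{\ell,i,j}$ define $\alpha_u:W\to W$, $w\mapsto wM_{\ell,i,j}$; $\omega_u=0$ if $j<\ell-1$ and $\omega_u=w_{\ell,i}$ if $j=\ell-1$; and $\nu_u=u_{\ell,i,(j+1)\bmod\ell}-u_{\ell,i,j}$. Then the $W$-coset-wise $\mathbb{F}_p$-affine function \[ f:V\to V,\quad w+u\mapsto \alpha_u(w)+u+\omega_u+\nu_u\quad(w\in W,u\in U) \] is a complete mapping of $V$ with cycle type $\prod_{\ell=1}^{p^t}\prod_{i=1}^{k_\ell}\operatorname{BU}_\ell(\gamma_{\ell,i})$.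
   Context: A complete mapping of an additive group $G$ is a permutation $h$ of $G$ such that $x\mapsto h(x)+x$ is also a permutation. Vectors are row vectors; for a $(d\times d)$-matrix $M$ over $\mathbb{F}_p$ and $v\in\mathbb{F}_p^d$, $\lambda(M,v)$ is the map $x\mapsto xM+v$ on $\mathbb{F}_p^d$. $\operatorname{CGL}_d(p)$ is the set of invertible $(d\times d)$-matrices over $\mathbb{F}_p$ not having $-1$ as an eigenvalue. The cycle type $\operatorname{CT}(\sigma)$ of a permutation $\sigma$ of a finite set $\Omega$ is the monomial $x_1^{k_1}\cdots x_{|\Omega|}^{k_{|\Omega|}}\in\mathbb{Q}[x_n:n\ge1]$ with $k_j$ the number of $j$-cycles. $\operatorname{BU}_\ell$ is the $\mathbb{Q}$-algebra endomorphism of $\mathbb{Q}[x_n:n\ge1]$ with $x_n\mapsto x_{\ell n}$. -}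

module Defs where

open import Algebra.Bundles using (CommutativeRing; Semiring)
open import Algebra.Definitions.RawSemiring as RawSemiringDefs using ()
open import Algebra.Structures using (IsCommutativeRing)
open import Data.Bool.Base using (if_then_else_)
open import Data.Fin.Base using (Fin; toℕ)
open import Data.Fin.Properties as Fin using ()
open import Data.List.Base as List using (List; []; _∷_; length; filter; deduplicate; iterate; allFin; cartesianProductWith)
open import Data.List.Membership.DecPropositional as DecMembership using ()
open import Data.List.Membership.Propositional using (_∈_)
open import Data.List.Membership.Propositional.Properties using (∈-allFin; ∈-cartesianProductWith⁺)
open import Data.List.Relation.Unary.AllPairs using ([]; _∷_)
open import Data.List.Relation.Unary.All using ([])
open import Data.List.Relation.Unary.Any using (here)
open import Data.List.Relation.Unary.Unique.Propositional using (Unique)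
open import Data.List.Relation.Unary.Unique.Propositional.Properties using (allFin⁺; cartesianProductWith⁺)
open import Data.Nat.Base as ℕ using (ℕ; zero; suc; NonZero; _∸_)
open import Data.Nat.DivMod using (_mod_)
open import Data.Nat.Properties as ℕ using (m*n≢0)
open import Data.Product.Base using (Σ; ∃; ∃₂; _×_; _,_; proj₁; proj₂)
open import Data.Rational.Base as ℚ using (ℚ; 0ℚ; 1ℚ)
open import Data.Rational.Properties as ℚ using ()
open import Data.Vec.Base as Vec using (Vec; []; _∷_; _++_; zipWith; replicate; tabulate; take; drop)
open import Data.Vec.Functional as Vector using ()
open import Data.Vec.Properties as Vec using (∷-injective)
open import Function.Definitions using (Bijective)
open import Relation.Binary.Definitions using (DecidableEquality; Decidable)
open import Relation.Binary.PropositionalEquality using (_≡_; _≢_; refl; cong)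
open import Relation.Nullary.Decidable using (does)
open import Relation.Nullary.Negation using (¬_)

------------------------------------------------------------------------
-- The polynomial ring ℚ[x_n : n ≥ 1], as the free commutative ℚ-algebra
-- on the x_n: terms modulo the congruence generated by the axioms of
-- commutative ℚ-algebras.

infixl 6 _⊕_
infixl 7 _⊗_
infix  4 _≈_

data ℚ[x] : Set where
  con     : ℚ → ℚ[x]
  x       : (n : ℕ) .{{_ : NonZero n}} → ℚ[x]
  _⊕_ _⊗_ : ℚ[x] → ℚ[x] → ℚ[x]

data _≈_ : ℚ[x] → ℚ[x] → Set where
  ≈-refl   : ∀ {a} → a ≈ a
  ≈-sym    : ∀ {a b} → a ≈ b → b ≈ a
  ≈-trans  : ∀ {a b c} → a ≈ b → b ≈ c → a ≈ c
  ⊕-cong   : ∀ {a a′ b b′} → a ≈ a′ → b ≈ b′ → a ⊕ b ≈ a′ ⊕ b′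
  ⊗-cong   : ∀ {a a′ b b′} → a ≈ a′ → b ≈ b′ → a ⊗ b ≈ a′ ⊗ b′
  ⊕-assoc  : ∀ a b c → (a ⊕ b) ⊕ c ≈ a ⊕ (b ⊕ c)
  ⊕-comm   : ∀ a b → a ⊕ b ≈ b ⊕ a
  ⊕-idˡ    : ∀ a → con 0ℚ ⊕ a ≈ a
  ⊗-assoc  : ∀ a b c → (a ⊗ b) ⊗ c ≈ a ⊗ (b ⊗ c)
  ⊗-comm   : ∀ a b → a ⊗ b ≈ b ⊗ a
  ⊗-idˡ    : ∀ a → con 1ℚ ⊗ a ≈ a
  ⊗-zeroˡ  : ∀ a → con 0ℚ ⊗ a ≈ con 0ℚ
  distribˡ : ∀ a b c → a ⊗ (b ⊕ c) ≈ (a ⊗ b) ⊕ (a ⊗ c)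
  con-+    : ∀ q r → con (q ℚ.+ r) ≈ con q ⊕ con r
  con-*    : ∀ q r → con (q ℚ.* r) ≈ con q ⊗ con r

⊝_ : ℚ[x] → ℚ[x]
⊝ a = con (ℚ.- 1ℚ) ⊗ a

distribʳ : ∀ a b c → (b ⊕ c) ⊗ a ≈ (b ⊗ a) ⊕ (c ⊗ a)
distribʳ a b c = ≈-trans (⊗-comm _ _) (≈-trans (distribˡ _ _ _) (⊕-cong (⊗-comm _ _) (⊗-comm _ _)))

⊝-inverseˡ : ∀ a → (⊝ a) ⊕ a ≈ con 0ℚ
⊝-inverseˡ a =
  ≈-trans (⊕-cong ≈-refl (≈-sym (⊗-idˡ a)))
  (≈-trans (≈-sym (distribʳ a (con (ℚ.- 1ℚ)) (con 1ℚ)))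
  (≈-trans (⊗-cong (≈-sym (con-+ (ℚ.- 1ℚ) 1ℚ)) ≈-refl) (⊗-zeroˡ a)))

isCommutativeRing : IsCommutativeRing _≈_ _⊕_ _⊗_ ⊝_ (con 0ℚ) (con 1ℚ)
isCommutativeRing = record
  { isRing = record
    { +-isAbelianGroup = record
      { isGroup = record
        { isMonoid = record
          { isSemigroup = record
            { isMagma = record
              { isEquivalence = record { refl = ≈-refl ; sym = ≈-sym ; trans = ≈-trans }
              ; ∙-cong = ⊕-cong
              }
            ; assoc = ⊕-assoc
            }
          ; identity = ⊕-idˡ , λ a → ≈-trans (⊕-comm _ _) (⊕-idˡ a)
          }
        ; inverse = ⊝-inverseˡ , λ a → ≈-trans (⊕-comm _ _) (⊝-inverseˡ a)
        ; ⁻¹-cong = ⊗-cong ≈-refl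
        }
      ; comm = ⊕-comm
      }
    ; *-cong = ⊗-cong
    ; *-assoc = ⊗-assoc
    ; *-identity = ⊗-idˡ , λ a → ≈-trans (⊗-comm _ _) (⊗-idˡ a)
    ; distrib = distribˡ , distribʳ
    }
  ; *-comm = ⊗-comm
  }

ℚ[x]-commutativeRing : CommutativeRing _ _
ℚ[x]-commutativeRing = record { isCommutativeRing = isCommutativeRing }

open RawSemiringDefs (Semiring.rawSemiring (CommutativeRing.semiring ℚ[x]-commutativeRing)) public
  using (_^_) renaming (product to ∏)

BU : (ℓ : ℕ) .{{_ : NonZero ℓ}} → ℚ[x] → ℚ[x]
BU ℓ (con q) = con q
BU ℓ (x n)   = x (ℓ ℕ.* n) {{m*n≢0 ℓ n}}
BU ℓ (a ⊕ b) = BU ℓ a ⊕ BU ℓ b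
BU ℓ (a ⊗ b) = BU ℓ a ⊗ BU ℓ b

BU-cong : ∀ ℓ .{{_ : NonZero ℓ}} {a b} → a ≈ b → BU ℓ a ≈ BU ℓ b
BU-cong ℓ ≈-refl           = ≈-refl
BU-cong ℓ (≈-sym e)        = ≈-sym (BU-cong ℓ e)
BU-cong ℓ (≈-trans e e′)   = ≈-trans (BU-cong ℓ e) (BU-cong ℓ e′)
BU-cong ℓ (⊕-cong e e′)    = ⊕-cong (BU-cong ℓ e) (BU-cong ℓ e′)
BU-cong ℓ (⊗-cong e e′)    = ⊗-cong (BU-cong ℓ e) (BU-cong ℓ e′)
BU-cong ℓ (⊕-assoc a b c)  = ⊕-assoc _ _ _
BU-cong ℓ (⊕-comm a b)     = ⊕-comm _ _
BU-cong ℓ (⊕-idˡ a)        = ⊕-idˡ _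
BU-cong ℓ (⊗-assoc a b c)  = ⊗-assoc _ _ _
BU-cong ℓ (⊗-comm a b)     = ⊗-comm _ _
BU-cong ℓ (⊗-idˡ a)        = ⊗-idˡ _
BU-cong ℓ (⊗-zeroˡ a)      = ⊗-zeroˡ _
BU-cong ℓ (distribˡ a b c) = distribˡ _ _ _
BU-cong ℓ (con-+ q r)      = con-+ q r
BU-cong ℓ (con-* q r)      = con-* q r

-- An index ℓ : Fin n stands for the cycle length ℓ + 1, so that Fin n
-- represents the range of lengths 1, …, n.
len : ∀ {n} → Fin n → ℕ
len ℓ = suc (toℕ ℓ)

monomial : ∀ {n} → (Fin n → ℕ) → ℚ[x]
monomial k = ∏ λ ℓ → x (len ℓ) ^ k ℓ

------------------------------------------------------------------------
-- Cycle types

record Finite (Ω : Set) : Set where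
  field
    _≟_      : DecidableEquality Ω
    elements : List Ω
    unique   : Unique elements
    complete : ∀ a → a ∈ elements

  size : ℕ
  size = length elements

-- These are meaningful only when σ is a permutation of Ω.
module _ {Ω : Set} (fin : Finite Ω) (σ : Ω → Ω) where
  open Finite fin

  -- Cycles have length at most |Ω|, so a, σ a, …, σ^(|Ω|-1) a runs
  -- through the whole cycle of a.
  SameCycle : Ω → Ω → Set
  SameCycle a b = b ∈ iterate σ a size

  sameCycle? : Decidable SameCycle
  sameCycle? a b = DecMembership._∈?_ _≟_ b (iterate σ a size)

  cycleLength : Ω → ℕ
  cycleLength a = length (filter (sameCycle? a) elements)

  -- One representative from each cycle.
  cycles : List Ω
  cycles = deduplicate sameCycle? elements

  numberOfCycles : ℕ → ℕ
  numberOfCycles j = length (filter (λ a → cycleLength a ℕ.≟ j) cycles)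

  CT : ℚ[x]
  CT = monomial {size} λ j → numberOfCycles (len j)

-- An enumeration of the cycles of g, where for every length ℓ = 1, …, n
-- there are k ℓ cycles of length ℓ, the i-th being
-- (u ℓ i 0, …, u ℓ i (ℓ-1)).
record CycleEnumeration {Ω : Set} (g : Ω → Ω) {n : ℕ} (k : Fin n → ℕ) : Set where
  field
    u               : (ℓ : Fin n) → Fin (k ℓ) → Fin (len ℓ) → Ω
    step            : ∀ ℓ i j → g (u ℓ i j) ≡ u ℓ i (suc (toℕ j) mod len ℓ)
    distinctEntries : ∀ ℓ i {j j′} → u ℓ i j ≡ u ℓ i j′ → j ≡ j′
    distinctCycles  : ∀ ℓ {i i′ j j′} → u ℓ i j ≡ u ℓ i′ j′ → i ≡ i′
    exhaustive      : ∀ a → ∃ λ ℓ → ∃₂ λ i j → u ℓ i j ≡ a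

IsPermutation : {A : Set} → (A → A) → Set
IsPermutation = Bijective _≡_ _≡_

IsCompleteMapping : {G : Set} → (G → G → G) → (G → G) → Set
IsCompleteMapping _+_ h = IsPermutation h × IsPermutation (λ a → h a + a)

------------------------------------------------------------------------
-- Linear algebra over 𝔽_p = ℤ/pℤ (a field when p is prime)

module LinearAlgebra (p : ℕ) .{{_ : NonZero p}} where

  infixl 6 _+ᶠ_ _+_ _-_
  infixl 7 _*ᶠ_ _•_ _·_ _⊡_

  𝔽 : Set
  𝔽 = Fin p

  0ᶠ 1ᶠ : 𝔽
  0ᶠ = 0 mod p
  1ᶠ = 1 mod p

  _+ᶠ_ _*ᶠ_ : 𝔽 → 𝔽 → 𝔽
  a +ᶠ b = (toℕ a ℕ.+ toℕ b) mod p
  a *ᶠ b = (toℕ a ℕ.* toℕ b) mod p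

  -ᶠ_ : 𝔽 → 𝔽
  -ᶠ a = (p ∸ toℕ a) mod p

  𝔽^ : ℕ → Set
  𝔽^ n = Vec 𝔽 n

  𝟎 : ∀ {n} → 𝔽^ n
  𝟎 = replicate _ 0ᶠ

  _+_ _-_ : ∀ {n} → 𝔽^ n → 𝔽^ n → 𝔽^ n
  _+_ = zipWith _+ᶠ_
  v - w = v + Vec.map -ᶠ_ w

  _•_ : ∀ {n} → 𝔽 → 𝔽^ n → 𝔽^ n
  c • v = Vec.map (c *ᶠ_) v

  -- Matrices are vectors of rows.
  Matrix : ℕ → ℕ → Set
  Matrix m n = Vec (𝔽^ n) m

  _·_ : ∀ {m n} → 𝔽^ m → Matrix m n → 𝔽^ n
  []      · []      = 𝟎
  (c ∷ v) · (r ∷ M) = c • r + v · M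

  _⊡_ : ∀ {l m n} → Matrix l m → Matrix m n → Matrix l n
  M ⊡ N = Vec.map (_· N) M

  𝟙 : ∀ {n} → Matrix n n
  𝟙 = tabulate λ i → tabulate λ j → if does (i Fin.≟ j) then 1ᶠ else 0ᶠ

  -- M 0 ⊡ M 1 ⊡ ⋯ ⊡ M (l-1), in this order.
  matrixProduct : ∀ {l n} → (Fin l → Matrix n n) → Matrix n n
  matrixProduct = Vector.foldr _⊡_ 𝟙

  affine : ∀ {m n} → Matrix m n → 𝔽^ n → 𝔽^ m → 𝔽^ n
  affine M v a = a · M + v

  IsInvertible : ∀ {n} → Matrix n n → Set
  IsInvertible M = ∃ λ N → M ⊡ N ≡ 𝟙 × N ⊡ M ≡ 𝟙

  IsEigenvalue : ∀ {n} → Matrix n n → 𝔽 → Set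
  IsEigenvalue M c = ∃ λ v → v ≢ 𝟎 × v · M ≡ c • v

  CGL : ∀ {n} → Matrix n n → Set
  CGL M = IsInvertible M × ¬ IsEigenvalue M (-ᶠ 1ᶠ)

  vectors : ∀ n → List (𝔽^ n)
  vectors zero    = [] ∷ []
  vectors (suc n) = cartesianProductWith _∷_ (allFin p) (vectors n)

  vectors-unique : ∀ n → Unique (vectors n)
  vectors-unique zero    = [] ∷ []
  vectors-unique (suc n) = cartesianProductWith⁺ _∷_ ∷-injective (allFin⁺ p) (vectors-unique n)

  vectors-complete : ∀ {n} (v : 𝔽^ n) → v ∈ vectors n
  vectors-complete []      = here refl
  vectors-complete (c ∷ v) = ∈-cartesianProductWith⁺ _∷_ (∈-allFin c) (vectors-complete v)

  𝔽^-finite : ∀ n → Finite (𝔽^ n)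
  𝔽^-finite n = record
    { _≟_      = Vec.≡-dec Fin._≟_
    ; elements = vectors n
    ; unique   = vectors-unique n
    ; complete = vectors-complete
    }

  -- 𝔽^(d+t) = W ⊕ U, where W = 𝔽^d and U = 𝔽^t sit on the first d and
  -- the last t coordinates.
  module _ {d t : ℕ} where

    fromW : 𝔽^ d → 𝔽^ (d ℕ.+ t)
    fromW w = w ++ 𝟎

    fromU : 𝔽^ t → 𝔽^ (d ℕ.+ t)
    fromU u = 𝟎 ++ u

  -- The restriction of f to each coset W + v is an affine function of
  -- w ∈ W.
  IsCosetwiseAffine : ∀ d {t} → (𝔽^ (d ℕ.+ t) → 𝔽^ (d ℕ.+ t)) → Set
  IsCosetwiseAffine d {t} f =
    ∀ v → Σ (Matrix d (d ℕ.+ t)) λ A → ∃ λ c → ∀ w → f (fromW w + v) ≡ affine A c w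

  module Construction
    {d t : ℕ} {g : 𝔽^ t → 𝔽^ t} {n : ℕ} {k : Fin n → ℕ} (E : CycleEnumeration g k)
    (M : (ℓ : Fin n) → Fin (k ℓ) → Fin (len ℓ) → Matrix d d)
    (w : (ℓ : Fin n) → Fin (k ℓ) → 𝔽^ d)
    where

    open CycleEnumeration E

    -- The (ℓ, i, j) with u ℓ i j ≡ a, unique by distinctness.
    position : 𝔽^ t → Σ (Fin n) λ ℓ → Fin (k ℓ) × Fin (len ℓ)
    position a = let ℓ , i , j , _ = exhaustive a in ℓ , i , j

    α : 𝔽^ t → 𝔽^ d → 𝔽^ d
    α a b = let ℓ , i , j = position a in b · M ℓ i j

    ω : 𝔽^ t → 𝔽^ d
    ω a = let ℓ , i , j = position a in if does (toℕ j ℕ.<? len ℓ ∸ 1) then 𝟎 else w ℓ i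

    ν : 𝔽^ t → 𝔽^ t
    ν a = let ℓ , i , j = position a in u ℓ i (suc (toℕ j) mod len ℓ) - u ℓ i j

    f : 𝔽^ (d ℕ.+ t) → 𝔽^ (d ℕ.+ t)
    f v = fromW (α a b) + fromU a + fromW (ω a) + fromU (ν a)
      where
      b = take d v
      a = drop d v

    γ : (ℓ : Fin n) → Fin (k ℓ) → ℚ[x]
    γ ℓ i = CT (𝔽^-finite d) (affine (matrixProduct (M ℓ i)) (w ℓ i))

{-# OPTIONS --safe #-}
module Submission where

-- Over the cycle (u₀, …, u_{ℓ-1}) of g, the map f permutes the fibres
-- W + u_j cyclically, and f^ℓ restricted to W + u₀ is the affine map
-- w ↦ w M₀ ⋯ M_{ℓ-1} + w_{ℓ,i}.  Hence a point of W + u₀ in a c-cycle of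
-- that affine map lies in an (ℓc)-cycle of f, and every cycle of f over
-- this cycle of g meets W + u₀ in exactly one cycle of the affine map.
-- Cycle types are compared as products over transversals of the cycles:
-- such a product does not depend on the transversal.  Completeness follows
-- from injectivity of f and f + id, fibre by fibre; for f + id this is the
-- absence of the eigenvalue -1.

open import Defs
open import Algebra.Bundles using (CommutativeRing)
open import Algebra.Definitions using (Associative; Commutative; LeftIdentity; RightIdentity; RightInverse)
import Algebra.Properties.CommutativeMonoid.Sum as CommutativeMonoidSum
open import Data.Bool.Base using (true; false; if_then_else_)
open import Data.Fin.Base using (Fin; zero; suc; toℕ; fromℕ; fromℕ<; inject₁)
open import Data.Fin.Properties as Fin using (toℕ-injective; toℕ-fromℕ<; toℕ-fromℕ; toℕ-inject₁; toℕ<n; toℕ≤pred[n]; pigeonhole)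
open import Data.List.Base as List using (List; []; _∷_; length; filter; map; foldr; iterate; applyUpTo; upTo; concat)
open import Data.List.Membership.Propositional using (_∈_)
open import Data.List.Membership.Propositional.Properties using (∈-applyUpTo⁺; ∈-applyUpTo⁻; ∈-filter⁺; ∈-filter⁻; ∈-map⁻; ∈-concat⁻)
import Data.List.Membership.Setoid as SetoidMembership
import Data.List.Membership.Setoid.Properties as Membershipₛ
open import Data.List.Properties using (length-iterate; map-upTo; map-cong; map-++)
import Data.List.Relation.Binary.Permutation.Setoid as SetoidPermutation
import Data.List.Relation.Binary.Permutation.Setoid.Properties as Permutationₛ
open import Data.List.Relation.Unary.All as All using (All; []; _∷_)
import Data.List.Relation.Unary.All.Properties as All
open import Data.List.Relation.Unary.AllPairs as AllPairs using (AllPairs; []; _∷_)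
import Data.List.Relation.Unary.AllPairs.Properties as AllPairs
open import Data.List.Relation.Unary.Any as Any using (Any; here; there)
import Data.List.Relation.Unary.Any.Properties as Any
open import Data.List.Relation.Unary.Unique.DecSetoid.Properties using (deduplicate-!)
open import Data.List.Relation.Unary.Unique.Propositional using (Unique)
open import Data.List.Relation.Unary.Unique.Propositional.Properties using (applyUpTo⁺₁; filter⁺)
import Data.List.Relation.Unary.Unique.Setoid as SetoidUnique
open import Data.Nat.Base as ℕ using (ℕ; zero; suc; NonZero; _%_; _/_; _∸_; _≤_; _<_; z≤n; s≤s)
open import Data.Nat.DivMod using (_mod_; m≡m%n+[m/n]*n; m%n<n; m%n%n≡m%n; m<n⇒m%n≡m; n%n≡0; [m+n]%n≡m%n; %-distribˡ-+; %-distribˡ-*)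
open import Data.Nat.Divisibility using (_∣_; divides; ∣-antisym; >⇒∤; m%n≡0⇒n∣m; *-monoʳ-∣)
open import Data.Nat.GeneralisedArithmetic using (fold; fold-+)
open import Data.Nat.Primality using (Prime)
import Data.Nat.Properties as ℕ
open import Data.Product.Base using (Σ; ∃; ∃₂; _×_; _,_; proj₁; proj₂)
open import Data.Rational.Base using (1ℚ)
open import Data.Vec.Base as Vec using ([]; _∷_; _++_; take; drop; tabulate)
open import Data.Vec.Properties as Vec using (zipWith-assoc; zipWith-comm; zipWith-identityˡ; zipWith-identityʳ; zipWith-inverseʳ; zipWith-++; tabulate-∘; take++drop≡id; ++-injective; ++-injectiveˡ; ++-injectiveʳ)
open import Function.Base using (_∘_)
open import Function.Definitions using (Injective)
open import Relation.Binary.Bundles using (Setoid; DecSetoid)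
open import Relation.Binary.PropositionalEquality using (_≡_; _≢_; refl; sym; trans; cong; cong₂; subst; setoid; module ≡-Reasoning)
open import Relation.Nullary.Decidable using (does; yes; no; dec-true; dec-false; decidable-stable)
open import Relation.Nullary.Negation using (¬_; contradiction)
open import Relation.Unary using (Decidable)

-- Products of variables

open CommutativeRing ℚ[x]-commutativeRing using (*-commutativeMonoid; *-isCommutativeMonoid) renaming (setoid to ℚ[x]-setoid)
open CommutativeMonoidSum *-commutativeMonoid using () renaming (sum-cong-≋ to ∏-cong; ∑-distrib-+ to ∏-distrib-⊗; sum-replicate-zero to ∏-replicate-1)

∏ˡ : List ℚ[x] → ℚ[x]
∏ˡ = foldr _⊗_ (con 1ℚ)

∏ˡ-++ : ∀ as bs → ∏ˡ (as List.++ bs) ≈ ∏ˡ as ⊗ ∏ˡ bs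
∏ˡ-++ []       bs = ≈-sym (⊗-idˡ _)
∏ˡ-++ (a ∷ as) bs = ≈-trans (⊗-cong ≈-refl (∏ˡ-++ as bs)) (≈-sym (⊗-assoc a _ _))

∏ˡ-concat-tabulate : ∀ {A : Set} (h : A → ℚ[x]) {n} (L : Fin n → List A) →
                     ∏ˡ (map h (concat (List.tabulate L))) ≈ ∏ (λ i → ∏ˡ (map h (L i)))
∏ˡ-concat-tabulate h {zero}  L = ≈-refl
∏ˡ-concat-tabulate h {suc n} L =
  ≈-trans (≡⇒≈ (cong ∏ˡ (map-++ h (L zero) _)))
  (≈-trans (∏ˡ-++ (map h (L zero)) _) (⊗-cong ≈-refl (∏ˡ-concat-tabulate h (L ∘ suc))))
  where
  ≡⇒≈ : ∀ {a b} → a ≡ b → a ≈ b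
  ≡⇒≈ refl = ≈-refl

-- The variable x n, with the junk value 1 for n = 0.
X : ℕ → ℚ[x]
X zero    = con 1ℚ
X (suc n) = x (suc n)

-- `BU ℓ` is multiplicative and multiplies each index by `ℓ`, which is the change of cycle length
-- from `a` to `e a`.
BU-∏ˡ : ∀ ℓ .{{_ : NonZero ℓ}} {A B : Set} {q : ℚ[x]} (h : A → ℕ) (h′ : B → ℕ) (e : A → B) as →
        q ≈ ∏ˡ (map (X ∘ h) as) → All (λ a → NonZero (h a) × h′ (e a) ≡ ℓ ℕ.* h a) as →
        BU ℓ q ≈ ∏ˡ (map (X ∘ h′) (map e as))
-- With `ℓ` a successor, `ℓ * suc m` computes to a successor, so `X` of it computes to a variable.
BU-∏ˡ ℓ@(suc _) h h′ e as q≈ lengths = ≈-trans (BU-cong ℓ q≈) (go as lengths)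
  where
  go : ∀ as → All (λ a → NonZero (h a) × h′ (e a) ≡ ℓ ℕ.* h a) as →
       BU ℓ (∏ˡ (map (X ∘ h) as)) ≈ ∏ˡ (map (X ∘ h′) (map e as))
  go []       []                    = ≈-refl
  go (a ∷ as) ((nz , eq) ∷ lengths) rewrite eq with h a
  ... | suc _ = ⊗-cong ≈-refl (go as lengths)

∏-δ : ∀ {n} (h : Fin n → ℚ[x]) i → ∏ (λ j → if does (len i ℕ.≟ len j) then h j else con 1ℚ) ≈ h i
∏-δ {suc n} h zero    =
  ≈-trans (⊗-cong ≈-refl (∏-replicate-1 n)) (≈-trans (⊗-comm _ _) (⊗-idˡ _))
∏-δ {suc n} h (suc i) = ≈-trans (⊗-idˡ _) (∏-δ (h ∘ suc) i)

-- Induction on the list: the head raises the exponent of exactly one variable, that of index `h a`,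
-- and so splits off the factor `X (h a)`. The bounds 1 ≤ `h a` ≤ `n` guarantee that this variable
-- occurs in the monomial.
monomial-count : ∀ {A : Set} {n} (h : A → ℕ) as → All (λ a → NonZero (h a) × h a ≤ n) as →
                 monomial {n} (λ j → length (filter (λ a → h a ℕ.≟ len j) as)) ≈ ∏ˡ (map (X ∘ h) as)
monomial-count {n = n} h []       []            = ∏-replicate-1 n
monomial-count {n = n} h (a ∷ as) ((nz , h≤n) ∷ rest) =
  ≈-trans (∏-cong {n} split)
  (≈-trans (∏-distrib-⊗ {n} δ _) (⊗-cong single (monomial-count h as rest)))
  where
  δ : Fin n → ℚ[x]
  δ j = if does (h a ℕ.≟ len j) then x (len j) else con 1ℚ
  split : ∀ j → x (len j) ^ length (filter (λ a → h a ℕ.≟ len j) (a ∷ as)) ≈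
                δ j ⊗ x (len j) ^ length (filter (λ a → h a ℕ.≟ len j) as)
  split j with does (h a ℕ.≟ len j)
  ... | true  = ≈-refl
  ... | false = ≈-sym (⊗-idˡ _)
  single : ∏ δ ≈ X (h a)
  single with h a
  -- Index `m` stands for length `m + 1`, so the bound on `h a` is exactly what `fromℕ<` asks for.
  ... | suc m with i ← fromℕ< h≤n | refl ← toℕ-fromℕ< h≤n = ∏-δ (λ j → x (len j)) i

-- Periods and cycles

least : ∀ {P : ℕ → Set} → Decidable P → ∀ n → P n → ∃ λ m → m ≤ n × P m × (∀ {k} → k < m → ¬ P k)
least P? n Pn with P? 0
... | yes P0 = 0 , z≤n , P0 , λ ()
least P? zero    P0 | no ¬P0 = contradiction P0 ¬P0
least P? (suc n) Pn | no ¬P0 =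
  let m , m≤n , Pm , minimal = least (P? ∘ suc) n Pn
  in suc m , s≤s m≤n , Pm , λ { {zero} _ → ¬P0 ; {suc k} (s≤s k<m) → minimal k<m }

-- Lists without repetition up to an equivalence

module _ {c ℓ} (S : Setoid c ℓ) where
  open Setoid S using () renaming (_≈_ to _≈ₛ_; refl to ≈ₛ-refl; sym to ≈ₛ-sym)
  open SetoidMembership S using () renaming (_∈_ to _∈ₛ_)
  open SetoidUnique S using () renaming (Unique to Uniqueₛ)
  open SetoidPermutation S

  -- Induction on `xs`: an equivalent of its head is found in `ys`, and both are removed. The setoid
  -- is general because equality of points serves to count the members of a cycle, and lying on the
  -- same cycle serves to compare transversals.
  unique∧set⇒↭ : ∀ {xs ys} → Uniqueₛ xs → Uniqueₛ ys →
                 (∀ {z} → z ∈ₛ xs → z ∈ₛ ys) → (∀ {z} → z ∈ₛ ys → z ∈ₛ xs) → xs ↭ ys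
  unique∧set⇒↭ {[]}     {[]}     _ _ _ _ = ↭-refl
  unique∧set⇒↭ {[]}     {y ∷ ys} _ _ _ ys⊆ with () ← ys⊆ (here ≈ₛ-refl)
  unique∧set⇒↭ {a ∷ xs} {ys} (a∉xs ∷ xs!) ys! xs⊆ ys⊆
    with us , vs , w , a≈w , ys≋ ← Membershipₛ.∈-∃++ S (xs⊆ (here ≈ₛ-refl))
    with ys↭ ← ↭-trans (↭-reflexive-≋ ys≋) (Permutationₛ.shift S (≈ₛ-sym a≈w) us vs)
    with a∉zs ∷ zs! ← Permutationₛ.Unique-resp-↭ S ys↭ ys!
    = ↭-trans (↭-prep a (unique∧set⇒↭ xs! zs! xs⊆zs zs⊆xs)) (↭-sym ys↭)
    where
    tail : ∀ {z xs} → All (λ y → ¬ a ≈ₛ y) xs → z ∈ₛ xs → ∀ {ys} → z ∈ₛ a ∷ ys → z ∈ₛ ys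
    -- A member of the shortened list that is equivalent to the removed head would contradict
    -- uniqueness.
    tail a∉xs z∈xs (here z≈a) =
      contradiction (Membershipₛ.∈-resp-≈ S z≈a z∈xs) (All.All¬⇒¬Any a∉xs)
    tail a∉xs z∈xs (there z∈ys) = z∈ys
    xs⊆zs : ∀ {z} → z ∈ₛ xs → z ∈ₛ us List.++ vs
    xs⊆zs z∈xs = tail a∉xs z∈xs (Permutationₛ.∈-resp-↭ S ys↭ (xs⊆ (there z∈xs)))
    zs⊆xs : ∀ {z} → z ∈ₛ us List.++ vs → z ∈ₛ xs
    zs⊆xs z∈zs = tail a∉zs z∈zs (ys⊆ (Permutationₛ.∈-resp-↭ S (↭-sym ys↭) (there z∈zs)))

-- `fold` adds each application on the outside, `iterate` on the inside; this reconciles the two.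
fold-shift : ∀ {A : Set} (σ : A → A) a m → fold (σ a) σ m ≡ fold a σ (suc m)
fold-shift σ a zero    = refl
fold-shift σ a (suc m) = cong σ (fold-shift σ a m)

iterate≡applyUpTo-fold : ∀ {A : Set} (σ : A → A) a n → iterate σ a n ≡ applyUpTo (fold a σ) n
iterate≡applyUpTo-fold σ a zero    = refl
iterate≡applyUpTo-fold σ a (suc n) = cong (a ∷_) (begin
  iterate σ (σ a) n               ≡⟨ iterate≡applyUpTo-fold σ (σ a) n ⟩
  applyUpTo (fold (σ a) σ) n      ≡⟨ map-upTo (fold (σ a) σ) n ⟨
  map (fold (σ a) σ) (upTo n)     ≡⟨ map-cong (fold-shift σ a) (upTo n) ⟩
  map (fold a σ ∘ suc) (upTo n)   ≡⟨ map-upTo (fold a σ ∘ suc) n ⟩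
  applyUpTo (fold a σ ∘ suc) n    ∎)
  where open ≡-Reasoning

fold-returns-* : ∀ {A : Set} (σ : A → A) {a} L → fold a σ L ≡ a → ∀ q → fold a σ (q ℕ.* L) ≡ a
fold-returns-* σ     L returns zero    = refl
fold-returns-* σ {a} L returns (suc q) =
  trans (fold-+ a σ L) (trans (cong (λ b → fold b σ L) (fold-returns-* σ L returns q)) returns)

-- The return times are exactly the multiples of `L`. Stating minimality as divisibility reduces
-- uniqueness, and the later transfer of periods to `f`, to arithmetic of divisors.
record Period {A : Set} (σ : A → A) (a : A) (L : ℕ) : Set where
  field
    nonZero : NonZero L
    returns : fold a σ L ≡ a
    minimal : ∀ m → fold a σ m ≡ a → L ∣ m

period-unique : ∀ {A : Set} {σ : A → A} {a L L′} → Period σ a L → Period σ a L′ → L ≡ L′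
period-unique P P′ = ∣-antisym (Period.minimal P _ (Period.returns P′)) (Period.minimal P′ _ (Period.returns P))

module _ {A : Set} {σ : A → A} (σ-injective : Injective _≡_ _≡_ σ) where

  fold-injective : ∀ m {a b} → fold a σ m ≡ fold b σ m → a ≡ b
  fold-injective zero    eq = eq
  fold-injective (suc m) eq = fold-injective m (σ-injective eq)

  fold-cancel : ∀ {a i j} → i ≤ j → fold a σ i ≡ fold a σ j → fold a σ (j ∸ i) ≡ a
  fold-cancel {a} {i} {j} i≤j eq = fold-injective i (begin
    fold (fold a σ (j ∸ i)) σ i  ≡⟨ fold-+ a σ i ⟨
    fold a σ (i ℕ.+ (j ∸ i))     ≡⟨ cong (fold a σ) (ℕ.m+[n∸m]≡n i≤j) ⟩
    fold a σ j                   ≡⟨ eq ⟨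
    fold a σ i                   ∎)
    where open ≡-Reasoning

-- Cycles of an injective self-map of a finite set

module Cycles {Ω : Set} (fin : Finite Ω) {σ : Ω → Ω} (σ-injective : Injective _≡_ _≡_ σ) where
  open Finite fin
  open ≡-Reasoning

  -- Among the first `size + 1` iterates of `a`, starting with `a` itself, two share a place in
  -- `elements`; injectivity cancels their common iterations. The successor records that the return
  -- time is positive.
  recurrent : ∀ a → ∃ λ m → suc m ≤ size × fold a σ (suc m) ≡ a
  recurrent a =
    let i , j , i<j , eq = pigeonhole (ℕ.n<1+n size) (λ i → Any.index (complete (fold a σ (toℕ i))))
        returns = fold-cancel σ-injective (ℕ.<⇒≤ i<j) (begin
          fold a σ (toℕ i)                                              ≡⟨ Any.lookup-index (complete (fold a σ (toℕ i))) ⟩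
          List.lookup elements (Any.index (complete (fold a σ (toℕ i)))) ≡⟨ cong (List.lookup elements) eq ⟩
          List.lookup elements (Any.index (complete (fold a σ (toℕ j)))) ≡⟨ Any.lookup-index (complete (fold a σ (toℕ j))) ⟨
          fold a σ (toℕ j)                                              ∎)
        suc-pred = ℕ.suc-pred (toℕ j ∸ toℕ i) {{ℕ.>-nonZero (ℕ.m<n⇒0<n∸m i<j)}}
    in ℕ.pred (toℕ j ∸ toℕ i)
     , subst (_≤ size) (sym suc-pred) (ℕ.≤-trans (ℕ.m∸n≤m (toℕ j) (toℕ i)) (toℕ≤pred[n] j))
     , trans (cong (fold a σ) suc-pred) returns

  period : ∀ a → ∃ λ L → L ≤ size × Period σ a L
  period a =
    let n , n<size , returnsₙ = recurrent a
        -- Searching over `suc m` skips the trivial return at time 0.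
        m , m≤n , returns , minimal = least (λ m → fold a σ (suc m) ≟ a) n returnsₙ
    in suc m , ℕ.≤-trans (s≤s m≤n) n<size , record
      { nonZero = _
      ; returns = returns
      ; minimal = λ k eq → m%n≡0⇒n∣m k (suc m) (remainder≡0 m returns minimal k eq)
      }
    where
    remainder≡0 : ∀ m → fold a σ (suc m) ≡ a → (∀ {k} → k < m → fold a σ (suc k) ≢ a) →
                  ∀ k → fold a σ k ≡ a → k % suc m ≡ 0
    remainder≡0 m returns minimal k eq with k % suc m in k%≡ | m%n<n k (suc m)
    ... | zero  | _       = refl
    -- Once whole turns of length `suc m` are discarded, a nonzero remainder would be a positive
    -- return time below the least one.
    ... | suc r | s≤s r<m = contradiction (begin
      fold a σ (suc r)                                    ≡⟨ cong (λ b → fold b σ (suc r)) (fold-returns-* σ (suc m) returns (k / suc m)) ⟨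
      fold (fold a σ (k / suc m ℕ.* suc m)) σ (suc r)     ≡⟨ fold-+ a σ (suc r) ⟨
      fold a σ (suc r ℕ.+ k / suc m ℕ.* suc m)            ≡⟨ cong (λ s → fold a σ (s ℕ.+ k / suc m ℕ.* suc m)) k%≡ ⟨
      fold a σ (k % suc m ℕ.+ k / suc m ℕ.* suc m)        ≡⟨ cong (fold a σ) (m≡m%n+[m/n]*n k (suc m)) ⟨
      fold a σ k                                          ≡⟨ eq ⟩
      a                                                   ∎) (minimal r<m)

  fold-mod : ∀ {a L} .{{_ : NonZero L}} → Period σ a L → ∀ m → fold a σ m ≡ fold a σ (m % L)
  fold-mod {a} {L} P m = begin
    fold a σ m                             ≡⟨ cong (fold a σ) (m≡m%n+[m/n]*n m L) ⟩
    fold a σ (m % L ℕ.+ m / L ℕ.* L)       ≡⟨ fold-+ a σ (m % L) ⟩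
    fold (fold a σ (m / L ℕ.* L)) σ (m % L) ≡⟨ cong (λ b → fold b σ (m % L)) (fold-returns-* σ L (Period.returns P) (m / L)) ⟩
    fold a σ (m % L)                       ∎

  ∈-iterate⁻ : ∀ {a b} n → b ∈ iterate σ a n → ∃ λ m → fold a σ m ≡ b
  ∈-iterate⁻ {a} n b∈ rewrite iterate≡applyUpTo-fold σ a n =
    let m , _ , b≡ = ∈-applyUpTo⁻ (fold a σ) b∈ in m , sym b≡

  ∈-iterate⁺ : ∀ {a L n} → Period σ a L → L ≤ n → ∀ m → fold a σ m ∈ iterate σ a n
  ∈-iterate⁺ {a} {L} {n} P L≤n m rewrite iterate≡applyUpTo-fold σ a n | fold-mod {{Period.nonZero P}} P m =
    ∈-applyUpTo⁺ (fold a σ) (ℕ.<-≤-trans (m%n<n m L {{Period.nonZero P}}) L≤n)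

  infix 4 _∼_
  _∼_ : Ω → Ω → Set
  _∼_ = SameCycle fin σ

  ∼⁻ : ∀ {a b} → a ∼ b → ∃ λ m → fold a σ m ≡ b
  ∼⁻ = ∈-iterate⁻ size

  -- The period is at most `size`, so every exponent reduces modulo it to one that `SameCycle`
  -- covers.
  ∼⁺ : ∀ {a b} m → fold a σ m ≡ b → a ∼ b
  ∼⁺ {a} m refl = let _ , L≤size , P = period a in ∈-iterate⁺ P L≤size m

  ∼-refl : ∀ {a} → a ∼ a
  ∼-refl = ∼⁺ 0 refl

  ∼-trans : ∀ {a b c} → a ∼ b → b ∼ c → a ∼ c
  ∼-trans {a} a∼b b∼c with m , refl ← ∼⁻ a∼b | n , refl ← ∼⁻ b∼c = ∼⁺ (n ℕ.+ m) (fold-+ a σ n)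

  ∼-sym : ∀ {a b} → a ∼ b → b ∼ a
  -- Another `m * L ∸ m` steps complete `m` full turns; `L` is positive, so the subtraction does not
  -- truncate.
  ∼-sym {a} a∼b with m , refl ← ∼⁻ a∼b | L , _ , P ← period a = ∼⁺ (m ℕ.* L ∸ m) (begin
    fold (fold a σ m) σ (m ℕ.* L ∸ m)   ≡⟨ fold-+ a σ (m ℕ.* L ∸ m) ⟨
    fold a σ (m ℕ.* L ∸ m ℕ.+ m)        ≡⟨ cong (fold a σ) (ℕ.m∸n+n≡m (ℕ.m≤m*n m L {{Period.nonZero P}})) ⟩
    fold a σ (m ℕ.* L)                  ≡⟨ fold-returns-* σ L (Period.returns P) m ⟩
    a                                   ∎)

  ∼-decSetoid : DecSetoid _ _
  ∼-decSetoid = record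
    { isDecEquivalence = record
      { isEquivalence = record { refl = ∼-refl ; sym = ∼-sym ; trans = ∼-trans }
      ; _≟_ = sameCycle? fin σ
      }
    }

  open DecSetoid ∼-decSetoid using () renaming (setoid to ∼-setoid)
  open SetoidUnique ∼-setoid using () renaming (Unique to DistinctCycles)
  open SetoidMembership ∼-setoid using () renaming (_∈_ to _∈∼_)

  -- The filtered `elements` and the first `L` iterates are repetition-free lists with the same
  -- members, hence of equal length.
  period⇒cycleLength : ∀ {a L} → Period σ a L → cycleLength fin σ a ≡ L
  period⇒cycleLength {a} {L} P =
    trans (Permutationₛ.xs↭ys⇒|xs|≡|ys| (setoid Ω)
             (unique∧set⇒↭ (setoid Ω) (filter⁺ (sameCycle? fin σ a) unique) iterate! to from))
          (length-iterate σ a L)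
    where
    iterate! : Unique (iterate σ a L)
    -- Equal iterates at times `i < j < L` would give a positive return time below `L`, which `L`
    -- cannot divide.
    iterate! rewrite iterate≡applyUpTo-fold σ a L = applyUpTo⁺₁ (fold a σ) L λ {i} {j} i<j j<L eq →
      >⇒∤ {{ℕ.>-nonZero (ℕ.m<n⇒0<n∸m i<j)}} (ℕ.≤-<-trans (ℕ.m∸n≤m j i) j<L)
          (Period.minimal P _ (fold-cancel σ-injective (ℕ.<⇒≤ i<j) eq))
    to : ∀ {b} → b ∈ filter (sameCycle? fin σ a) elements → b ∈ iterate σ a L
    to b∈ with m , refl ← ∼⁻ (proj₂ (∈-filter⁻ (sameCycle? fin σ a) {xs = elements} b∈)) = ∈-iterate⁺ P ℕ.≤-refl m
    from : ∀ {b} → b ∈ iterate σ a L → b ∈ filter (sameCycle? fin σ a) elements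
    from b∈ with m , refl ← ∈-iterate⁻ L b∈ = ∈-filter⁺ (sameCycle? fin σ a) (complete _) (∼⁺ m refl)

  cycleLength-period : ∀ a → Period σ a (cycleLength fin σ a)
  cycleLength-period a with L , _ , P ← period a = subst (Period σ a) (sym (period⇒cycleLength P)) P

  cycleLength≤size : ∀ a → cycleLength fin σ a ≤ size
  cycleLength≤size a with L , L≤size , P ← period a = subst (_≤ size) (sym (period⇒cycleLength P)) L≤size

  -- Powers of `σ` commute and are injective, so `a` and `fold a σ m` have the same return times.
  cycleLength-cong : ∀ {a b} → a ∼ b → cycleLength fin σ a ≡ cycleLength fin σ b
  cycleLength-cong {a} a∼b with m , refl ← ∼⁻ a∼b = sym (period⇒cycleLength (record
    { nonZero = nonZero
    ; returns = trans (commute L) (cong (λ b → fold b σ m) returns)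
    ; minimal = λ k eq → minimal k (fold-injective σ-injective m (trans (sym (commute k)) eq))
    }))
    where
    L = cycleLength fin σ a
    open Period (cycleLength-period a)
    commute : ∀ k → fold (fold a σ m) σ k ≡ fold (fold a σ k) σ m
    commute k = trans (sym (fold-+ a σ k)) (trans (cong (fold a σ) (ℕ.+-comm k m)) (fold-+ a σ m))

  Transversal : List Ω → Set
  Transversal R = DistinctCycles R × (∀ a → a ∈∼ R)

  cycles-transversal : Transversal (cycles fin σ)
  cycles-transversal =
    deduplicate-! ∼-decSetoid elements ,
    λ a → Membershipₛ.∈-deduplicate⁺ ∼-setoid (sameCycle? fin σ) (λ c∼b a∼b → ∼-trans a∼b (∼-sym c∼b))
            (Any.map (λ { refl → ∼-refl }) (complete a))

  -- Any two transversals are permutations of each other up to `∼`, and the cycle length is constant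
  -- on cycles. So the product does not change when the transversal `cycles` from the definition of
  -- `CT` is replaced by `R`.
  CT-transversal : ∀ {R} → Transversal R → CT fin σ ≈ ∏ˡ (map (X ∘ cycleLength fin σ) R)
  CT-transversal (R! , R-complete) =
    let cycles! , cycles-complete = cycles-transversal in
    ≈-trans (monomial-count (cycleLength fin σ) (cycles fin σ)
               (All.universal (λ a → Period.nonZero (cycleLength-period a) , cycleLength≤size a) _))
            (Permutationₛ.foldr-commMonoid ℚ[x]-setoid *-isCommutativeMonoid
               (Permutationₛ.map⁺ ∼-setoid ℚ[x]-setoid (λ a∼b → Setoid.reflexive ℚ[x]-setoid (cong X (cycleLength-cong a∼b)))
                 (unique∧set⇒↭ ∼-setoid cycles! R! (λ _ → R-complete _) (λ _ → cycles-complete _))))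

  -- The preimage of `b` is its predecessor on its own cycle.
  injective⇒permutation : IsPermutation σ
  injective⇒permutation = σ-injective , λ b → let m , _ , eq = recurrent b in fold b σ m , λ { refl → eq }

-- Linear algebra over ℤ/pℤ

module ModProperties (p : ℕ) .{{_ : NonZero p}} where

  toℕ-mod : ∀ m → toℕ (m mod p) ≡ m % p
  toℕ-mod m = toℕ-fromℕ< (m%n<n m p)

  mod-cong : ∀ m n → m % p ≡ n % p → m mod p ≡ n mod p
  mod-cong m n eq = toℕ-injective (trans (toℕ-mod m) (trans eq (sym (toℕ-mod n))))

  mod-toℕ : ∀ (a : Fin p) → toℕ a mod p ≡ a
  mod-toℕ a = toℕ-injective (trans (toℕ-mod (toℕ a)) (m<n⇒m%n≡m (toℕ<n a)))

  -- Used with a cycle length as modulus, to follow positions along a cycle.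
  mod-suc : ∀ m → suc (toℕ (m mod p)) mod p ≡ suc m mod p
  mod-suc m = mod-cong (suc (toℕ (m mod p))) (suc m) (begin
    suc (toℕ (m mod p)) % p          ≡⟨ cong (λ r → suc r % p) (toℕ-mod m) ⟩
    (1 ℕ.+ m % p) % p                ≡⟨ %-distribˡ-+ 1 (m % p) p ⟩
    (1 % p ℕ.+ m % p % p) % p        ≡⟨ cong (λ r → (1 % p ℕ.+ r) % p) (m%n%n≡m%n m p) ⟩
    (1 % p ℕ.+ m % p) % p            ≡⟨ %-distribˡ-+ 1 m p ⟨
    suc m % p                        ∎)
    where open ≡-Reasoning

module LinearAlgebraProperties (p : ℕ) .{{_ : NonZero p}} where
  open LinearAlgebra p
  open ModProperties p
  open ≡-Reasoning

  mod-+ : ∀ m n → (m mod p) +ᶠ (n mod p) ≡ (m ℕ.+ n) mod p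
  mod-+ m n = mod-cong _ (m ℕ.+ n) (trans (cong₂ (λ a b → (a ℕ.+ b) % p) (toℕ-mod m) (toℕ-mod n)) (sym (%-distribˡ-+ m n p)))

  mod-* : ∀ m n → (m mod p) *ᶠ (n mod p) ≡ (m ℕ.* n) mod p
  mod-* m n = mod-cong _ (m ℕ.* n) (trans (cong₂ (λ a b → (a ℕ.* b) % p) (toℕ-mod m) (toℕ-mod n)) (sym (%-distribˡ-* m n p)))

  -- Reductions of single arguments are pulled outside, so that the ring laws descend from ℕ.
  +ᶠ-modˡ : ∀ m b → (m mod p) +ᶠ b ≡ (m ℕ.+ toℕ b) mod p
  +ᶠ-modˡ m b = trans (cong ((m mod p) +ᶠ_) (sym (mod-toℕ b))) (mod-+ m (toℕ b))

  +ᶠ-modʳ : ∀ a n → a +ᶠ (n mod p) ≡ (toℕ a ℕ.+ n) mod p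
  +ᶠ-modʳ a n = trans (cong (_+ᶠ (n mod p)) (sym (mod-toℕ a))) (mod-+ (toℕ a) n)

  *ᶠ-modˡ : ∀ m b → (m mod p) *ᶠ b ≡ (m ℕ.* toℕ b) mod p
  *ᶠ-modˡ m b = trans (cong ((m mod p) *ᶠ_) (sym (mod-toℕ b))) (mod-* m (toℕ b))

  *ᶠ-modʳ : ∀ a n → a *ᶠ (n mod p) ≡ (toℕ a ℕ.* n) mod p
  *ᶠ-modʳ a n = trans (cong (_*ᶠ (n mod p)) (sym (mod-toℕ a))) (mod-* (toℕ a) n)

  +ᶠ-assoc : Associative _≡_ _+ᶠ_
  +ᶠ-assoc a b c = begin
    a +ᶠ b +ᶠ c                           ≡⟨ +ᶠ-modˡ _ c ⟩
    (toℕ a ℕ.+ toℕ b ℕ.+ toℕ c) mod p     ≡⟨ cong (_mod p) (ℕ.+-assoc (toℕ a) (toℕ b) (toℕ c)) ⟩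
    (toℕ a ℕ.+ (toℕ b ℕ.+ toℕ c)) mod p   ≡⟨ +ᶠ-modʳ a _ ⟨
    a +ᶠ (b +ᶠ c)                         ∎

  +ᶠ-comm : Commutative _≡_ _+ᶠ_
  +ᶠ-comm a b = cong (_mod p) (ℕ.+-comm (toℕ a) (toℕ b))

  +ᶠ-identityˡ : LeftIdentity _≡_ 0ᶠ _+ᶠ_
  +ᶠ-identityˡ a = trans (+ᶠ-modˡ 0 a) (mod-toℕ a)

  +ᶠ-identityʳ : RightIdentity _≡_ 0ᶠ _+ᶠ_
  +ᶠ-identityʳ a = trans (+ᶠ-comm a 0ᶠ) (+ᶠ-identityˡ a)

  +ᶠ-inverseʳ : RightInverse _≡_ 0ᶠ -ᶠ_ _+ᶠ_
  +ᶠ-inverseʳ a = begin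
    a +ᶠ (-ᶠ a)                       ≡⟨ +ᶠ-modʳ a _ ⟩
    (toℕ a ℕ.+ (p ∸ toℕ a)) mod p     ≡⟨ cong (_mod p) (ℕ.m+[n∸m]≡n (ℕ.<⇒≤ (toℕ<n a))) ⟩
    p mod p                           ≡⟨ mod-cong p 0 (trans (n%n≡0 p) (sym (m<n⇒m%n≡m (ℕ.>-nonZero⁻¹ p)))) ⟩
    0ᶠ                                ∎

  *ᶠ-assoc : Associative _≡_ _*ᶠ_
  *ᶠ-assoc a b c = begin
    a *ᶠ b *ᶠ c                           ≡⟨ *ᶠ-modˡ _ c ⟩
    (toℕ a ℕ.* toℕ b ℕ.* toℕ c) mod p     ≡⟨ cong (_mod p) (ℕ.*-assoc (toℕ a) (toℕ b) (toℕ c)) ⟩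
    (toℕ a ℕ.* (toℕ b ℕ.* toℕ c)) mod p   ≡⟨ *ᶠ-modʳ a _ ⟨
    a *ᶠ (b *ᶠ c)                         ∎

  *ᶠ-comm : Commutative _≡_ _*ᶠ_
  *ᶠ-comm a b = cong (_mod p) (ℕ.*-comm (toℕ a) (toℕ b))

  *ᶠ-identityˡ : LeftIdentity _≡_ 1ᶠ _*ᶠ_
  *ᶠ-identityˡ a = trans (*ᶠ-modˡ 1 a) (trans (cong (_mod p) (ℕ.*-identityˡ (toℕ a))) (mod-toℕ a))

  *ᶠ-identityʳ : RightIdentity _≡_ 1ᶠ _*ᶠ_
  *ᶠ-identityʳ a = trans (*ᶠ-comm a 1ᶠ) (*ᶠ-identityˡ a)

  *ᶠ-zeroˡ : ∀ a → 0ᶠ *ᶠ a ≡ 0ᶠ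
  *ᶠ-zeroˡ a = *ᶠ-modˡ 0 a

  *ᶠ-zeroʳ : ∀ a → a *ᶠ 0ᶠ ≡ 0ᶠ
  *ᶠ-zeroʳ a = trans (*ᶠ-comm a 0ᶠ) (*ᶠ-zeroˡ a)

  *ᶠ-distribˡ : ∀ a b c → a *ᶠ (b +ᶠ c) ≡ a *ᶠ b +ᶠ a *ᶠ c
  *ᶠ-distribˡ a b c = begin
    a *ᶠ (b +ᶠ c)                                ≡⟨ *ᶠ-modʳ a _ ⟩
    (toℕ a ℕ.* (toℕ b ℕ.+ toℕ c)) mod p          ≡⟨ cong (_mod p) (ℕ.*-distribˡ-+ (toℕ a) (toℕ b) (toℕ c)) ⟩
    (toℕ a ℕ.* toℕ b ℕ.+ toℕ a ℕ.* toℕ c) mod p  ≡⟨ mod-+ (toℕ a ℕ.* toℕ b) (toℕ a ℕ.* toℕ c) ⟨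
    a *ᶠ b +ᶠ a *ᶠ c                             ∎

  *ᶠ-distribʳ : ∀ a b c → (a +ᶠ b) *ᶠ c ≡ a *ᶠ c +ᶠ b *ᶠ c
  *ᶠ-distribʳ a b c = begin
    (a +ᶠ b) *ᶠ c    ≡⟨ *ᶠ-comm (a +ᶠ b) c ⟩
    c *ᶠ (a +ᶠ b)    ≡⟨ *ᶠ-distribˡ c a b ⟩
    c *ᶠ a +ᶠ c *ᶠ b ≡⟨ cong₂ _+ᶠ_ (*ᶠ-comm c a) (*ᶠ-comm c b) ⟩
    a *ᶠ c +ᶠ b *ᶠ c ∎

  -- Vectors and matrices

  +-assoc : ∀ {n} → Associative _≡_ (_+_ {n})
  +-assoc = zipWith-assoc +ᶠ-assoc

  +-comm : ∀ {n} → Commutative _≡_ (_+_ {n})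
  +-comm = zipWith-comm +ᶠ-comm

  +-identityˡ : ∀ {n} → LeftIdentity _≡_ 𝟎 (_+_ {n})
  +-identityˡ = zipWith-identityˡ +ᶠ-identityˡ

  +-identityʳ : ∀ {n} → RightIdentity _≡_ 𝟎 (_+_ {n})
  +-identityʳ = zipWith-identityʳ +ᶠ-identityʳ

  v-v≡𝟎 : ∀ {n} (v : 𝔽^ n) → v - v ≡ 𝟎
  v-v≡𝟎 = zipWith-inverseʳ +ᶠ-inverseʳ

  v+[w-v]≡w : ∀ {n} (v w : 𝔽^ n) → v + (w - v) ≡ w
  v+[w-v]≡w v w = begin
    v + (w - v)              ≡⟨ +-comm v (w - v) ⟩
    w + Vec.map -ᶠ_ v + v    ≡⟨ +-assoc w _ v ⟩
    w + (Vec.map -ᶠ_ v + v)  ≡⟨ cong (w +_) (trans (+-comm _ v) (v-v≡𝟎 v)) ⟩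
    w + 𝟎                    ≡⟨ +-identityʳ w ⟩
    w                        ∎

  [v+w]-w≡v : ∀ {n} (v w : 𝔽^ n) → (v + w) - w ≡ v
  [v+w]-w≡v v w = trans (+-assoc v w _) (trans (cong (v +_) (v-v≡𝟎 w)) (+-identityʳ v))

  +-cancelʳ : ∀ {n} (u {v w} : 𝔽^ n) → v + u ≡ w + u → v ≡ w
  +-cancelʳ u {v} {w} eq = trans (sym ([v+w]-w≡v v u)) (trans (cong (_- u) eq) ([v+w]-w≡v w u))

  v-w≡𝟎⇒v≡w : ∀ {n} (v w : 𝔽^ n) → v - w ≡ 𝟎 → v ≡ w
  v-w≡𝟎⇒v≡w v w eq = +-cancelʳ (Vec.map -ᶠ_ w) (trans eq (sym (v-v≡𝟎 w)))

  +-interchange : ∀ {n} (a b c d : 𝔽^ n) → (a + b) + (c + d) ≡ (a + c) + (b + d)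
  +-interchange a b c d = begin
    (a + b) + (c + d)  ≡⟨ +-assoc a b (c + d) ⟩
    a + (b + (c + d))  ≡⟨ cong (a +_) (trans (sym (+-assoc b c d)) (trans (cong (_+ d) (+-comm b c)) (+-assoc c b d))) ⟩
    a + (c + (b + d))  ≡⟨ +-assoc a c (b + d) ⟨
    (a + c) + (b + d)  ∎

  •-distribˡ : ∀ {n} c (v w : 𝔽^ n) → c • (v + w) ≡ c • v + c • w
  •-distribˡ c []      []      = refl
  •-distribˡ c (a ∷ v) (b ∷ w) = cong₂ _∷_ (*ᶠ-distribˡ c a b) (•-distribˡ c v w)

  •-distribʳ : ∀ {n} a b (v : 𝔽^ n) → (a +ᶠ b) • v ≡ a • v + b • v
  •-distribʳ a b []      = refl
  •-distribʳ a b (c ∷ v) = cong₂ _∷_ (*ᶠ-distribʳ a b c) (•-distribʳ a b v)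

  •-assoc : ∀ {n} a b (v : 𝔽^ n) → (a *ᶠ b) • v ≡ a • (b • v)
  •-assoc a b []      = refl
  •-assoc a b (c ∷ v) = cong₂ _∷_ (*ᶠ-assoc a b c) (•-assoc a b v)

  •-identity : ∀ {n} (v : 𝔽^ n) → 1ᶠ • v ≡ v
  •-identity []      = refl
  •-identity (c ∷ v) = cong₂ _∷_ (*ᶠ-identityˡ c) (•-identity v)

  •-zeroˡ : ∀ {n} (v : 𝔽^ n) → 0ᶠ • v ≡ 𝟎
  •-zeroˡ []      = refl
  •-zeroˡ (c ∷ v) = cong₂ _∷_ (*ᶠ-zeroˡ c) (•-zeroˡ v)

  •-zeroʳ : ∀ {n} c → c • 𝟎 {n} ≡ 𝟎
  •-zeroʳ {zero}  c = refl
  •-zeroʳ {suc n} c = cong₂ _∷_ (*ᶠ-zeroʳ c) (•-zeroʳ c)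

  ·-distribʳ : ∀ {m n} (v w : 𝔽^ m) (M : Matrix m n) → (v + w) · M ≡ v · M + w · M
  ·-distribʳ []      []      []      = sym (+-identityˡ 𝟎)
  ·-distribʳ (a ∷ v) (b ∷ w) (r ∷ M) = begin
    (a +ᶠ b) • r + (v + w) · M           ≡⟨ cong₂ _+_ (•-distribʳ a b r) (·-distribʳ v w M) ⟩
    (a • r + b • r) + (v · M + w · M)    ≡⟨ +-interchange (a • r) (b • r) (v · M) (w · M) ⟩
    (a • r + v · M) + (b • r + w · M)    ∎

  ·-• : ∀ {m n} c (v : 𝔽^ m) (M : Matrix m n) → (c • v) · M ≡ c • (v · M)
  ·-• c []      []      = sym (•-zeroʳ c)
  ·-• c (a ∷ v) (r ∷ M) = begin
    (c *ᶠ a) • r + (c • v) · M  ≡⟨ cong₂ _+_ (•-assoc c a r) (·-• c v M) ⟩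
    c • (a • r) + c • (v · M)   ≡⟨ •-distribˡ c (a • r) (v · M) ⟨
    c • (a • r + v · M)         ∎

  𝟎-· : ∀ {m n} (M : Matrix m n) → 𝟎 · M ≡ 𝟎
  𝟎-· M = begin
    𝟎 · M          ≡⟨ cong (_· M) (•-zeroˡ 𝟎) ⟨
    (0ᶠ • 𝟎) · M   ≡⟨ ·-• 0ᶠ 𝟎 M ⟩
    0ᶠ • (𝟎 · M)   ≡⟨ •-zeroˡ (𝟎 · M) ⟩
    𝟎              ∎

  ·-⊡ : ∀ {l m n} (v : 𝔽^ l) (M : Matrix l m) (N : Matrix m n) → v · (M ⊡ N) ≡ (v · M) · N
  ·-⊡ []      []      N = sym (𝟎-· N)
  ·-⊡ (c ∷ v) (r ∷ M) N = begin
    c • (r · N) + v · (M ⊡ N)  ≡⟨ cong₂ _+_ (sym (·-• c r N)) (·-⊡ v M N) ⟩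
    (c • r) · N + (v · M) · N  ≡⟨ ·-distribʳ (c • r) (v · M) N ⟨
    (c • r + v · M) · N        ∎

  -- For `·-identity`: the rows of `𝟙` after the first are those of the smaller `𝟙` with a 0 in
  -- front.
  ·-map-0∷ : ∀ {m n} (v : 𝔽^ m) (M : Matrix m n) → v · Vec.map (0ᶠ ∷_) M ≡ 0ᶠ ∷ v · M
  ·-map-0∷ []      []      = refl
  ·-map-0∷ (c ∷ v) (r ∷ M) = begin
    c • (0ᶠ ∷ r) + v · Vec.map (0ᶠ ∷_) M  ≡⟨ cong (c • (0ᶠ ∷ r) +_) (·-map-0∷ v M) ⟩
    c *ᶠ 0ᶠ +ᶠ 0ᶠ ∷ c • r + v · M         ≡⟨ cong (_∷ c • r + v · M) (trans (+ᶠ-identityʳ _) (*ᶠ-zeroʳ c)) ⟩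
    0ᶠ ∷ c • r + v · M                    ∎

  -- Padding the rows with zeros lets a matrix on W take values in W ⊕ U, as `IsCosetwiseAffine`
  -- demands.
  ·-map-++𝟎 : ∀ {m n} k (v : 𝔽^ m) (M : Matrix m n) → v · Vec.map (_++ 𝟎 {k}) M ≡ v · M ++ 𝟎 {k}
  ·-map-++𝟎 {n = n} k [] [] = 𝟎≡𝟎++𝟎 n
    where
    𝟎≡𝟎++𝟎 : ∀ n → 𝟎 {n ℕ.+ k} ≡ 𝟎 {n} ++ 𝟎
    𝟎≡𝟎++𝟎 zero    = refl
    𝟎≡𝟎++𝟎 (suc n) = cong (0ᶠ ∷_) (𝟎≡𝟎++𝟎 n)
  ·-map-++𝟎 k (c ∷ v) (r ∷ M) = begin
    c • (r ++ 𝟎) + v · Vec.map (_++ 𝟎) M  ≡⟨ cong₂ _+_ (Vec.map-++ (c *ᶠ_) r 𝟎) (·-map-++𝟎 k v M) ⟩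
    (c • r ++ c • 𝟎) + (v · M ++ 𝟎)       ≡⟨ zipWith-++ _+ᶠ_ (c • r) (c • 𝟎) (v · M) 𝟎 ⟩
    (c • r + v · M) ++ (c • 𝟎 + 𝟎)        ≡⟨ cong ((c • r + v · M) ++_) (trans (+-identityʳ _) (•-zeroʳ c)) ⟩
    (c • r + v · M) ++ 𝟎                  ∎

  ·-identity : ∀ {n} (v : 𝔽^ n) → v · 𝟙 ≡ v
  ·-identity []      = refl
  ·-identity {suc n} (c ∷ v) = begin
    c • (1ᶠ ∷ tabulate λ _ → 0ᶠ) + v · tabulate (λ i → 0ᶠ ∷ row i)
      ≡⟨ cong₂ (λ r M → c • (1ᶠ ∷ r) + v · M) (tabulate-const n) (tabulate-∘ (0ᶠ ∷_) row) ⟩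
    c • (1ᶠ ∷ 𝟎) + v · Vec.map (0ᶠ ∷_) 𝟙
      ≡⟨ cong (c • (1ᶠ ∷ 𝟎) +_) (trans (·-map-0∷ v 𝟙) (cong (0ᶠ ∷_) (·-identity v))) ⟩
    c *ᶠ 1ᶠ +ᶠ 0ᶠ ∷ c • 𝟎 + v
      ≡⟨ cong₂ _∷_ (trans (+ᶠ-identityʳ _) (*ᶠ-identityʳ c)) (trans (cong (_+ v) (•-zeroʳ c)) (+-identityˡ v)) ⟩
    c ∷ v ∎
    where
    row : Fin n → 𝔽^ n
    row i = tabulate λ j → if does (i Fin.≟ j) then 1ᶠ else 0ᶠ
    tabulate-const : ∀ n → tabulate {n = n} (λ _ → 0ᶠ) ≡ 𝟎
    tabulate-const zero    = refl
    tabulate-const (suc n) = cong (0ᶠ ∷_) (tabulate-const n)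

  invertible⇒injective : ∀ {n} {M : Matrix n n} → IsInvertible M → ∀ {v w} → v · M ≡ w · M → v ≡ w
  invertible⇒injective {M = M} (N , MN≡𝟙 , _) {v} {w} eq =
    trans (sym (cancel v)) (trans (cong (_· N) eq) (cancel w))
    where
    cancel : ∀ v → (v · M) · N ≡ v
    cancel v = trans (sym (·-⊡ v M N)) (trans (cong (v ·_) MN≡𝟙) (·-identity v))

  v+w≡𝟎⇒v≡-1•w : ∀ {n} (v w : 𝔽^ n) → v + w ≡ 𝟎 → v ≡ (-ᶠ 1ᶠ) • w
  v+w≡𝟎⇒v≡-1•w v w eq = +-cancelʳ w (begin
    v + w                       ≡⟨ eq ⟩
    𝟎                           ≡⟨ •-zeroˡ w ⟨
    0ᶠ • w                      ≡⟨ cong (_• w) (trans (+ᶠ-comm _ 1ᶠ) (+ᶠ-inverseʳ 1ᶠ)) ⟨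
    ((-ᶠ 1ᶠ) +ᶠ 1ᶠ) • w         ≡⟨ •-distribʳ (-ᶠ 1ᶠ) 1ᶠ w ⟩
    (-ᶠ 1ᶠ) • w + 1ᶠ • w        ≡⟨ cong ((-ᶠ 1ᶠ) • w +_) (•-identity w) ⟩
    (-ᶠ 1ᶠ) • w + w             ∎)

  -- By linearity `v - w` is mapped to its negative, so it would be an eigenvector for -1 if it were
  -- nonzero. Equality of vectors is decidable, so refuting `v - w ≢ 𝟎` suffices.
  noEigenvalue-1⇒injective : ∀ {n} {M : Matrix n n} → ¬ IsEigenvalue M (-ᶠ 1ᶠ) →
                             ∀ {v w} → v · M + v ≡ w · M + w → v ≡ w
  noEigenvalue-1⇒injective {M = M} ¬eig {v} {w} eq =
    v-w≡𝟎⇒v≡w v w (decidable-stable (Vec.≡-dec Fin._≟_ (v - w) 𝟎) λ v-w≢𝟎 →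
      ¬eig (v - w , v-w≢𝟎 , v+w≡𝟎⇒v≡-1•w _ _ (+-cancelʳ (w · M + w) (begin
        ((v - w) · M + (v - w)) + (w · M + w)  ≡⟨ +-interchange ((v - w) · M) (v - w) (w · M) w ⟩
        ((v - w) · M + w · M) + (v - w + w)    ≡⟨ cong (_+ (v - w + w)) (·-distribʳ (v - w) w M) ⟨
        (v - w + w) · M + (v - w + w)          ≡⟨ cong (λ a → a · M + a) (trans (+-comm (v - w) w) (v+[w-v]≡w w v)) ⟩
        v · M + v                              ≡⟨ eq ⟩
        w · M + w                              ≡⟨ +-identityˡ _ ⟨
        𝟎 + (w · M + w)                        ∎))))

-- The construction

module CycleEnumerationProperties {Ω : Set} {g : Ω → Ω} {n} {k : Fin n → ℕ} (E : CycleEnumeration g k) where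
  open CycleEnumeration E
  open ≡-Reasoning

  fold-u : ∀ ℓ i j m → fold (u ℓ i j) g m ≡ u ℓ i ((toℕ j ℕ.+ m) mod len ℓ)
  fold-u ℓ i j zero = cong (u ℓ i) (begin
    j                             ≡⟨ mod-toℕ j ⟨
    toℕ j mod len ℓ               ≡⟨ cong (_mod len ℓ) (ℕ.+-identityʳ (toℕ j)) ⟨
    (toℕ j ℕ.+ 0) mod len ℓ       ∎)
    where open ModProperties (len ℓ)
  fold-u ℓ i j (suc m) = begin
    g (fold (u ℓ i j) g m)                       ≡⟨ cong g (fold-u ℓ i j m) ⟩
    g (u ℓ i (j+m mod len ℓ))                    ≡⟨ step ℓ i _ ⟩
    u ℓ i (suc (toℕ (j+m mod len ℓ)) mod len ℓ)  ≡⟨ cong (u ℓ i) (mod-suc j+m) ⟩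
    u ℓ i (suc j+m mod len ℓ)                    ≡⟨ cong (λ s → u ℓ i (s mod len ℓ)) (ℕ.+-suc (toℕ j) m) ⟨
    u ℓ i ((toℕ j ℕ.+ suc m) mod len ℓ)          ∎
    where
    j+m = toℕ j ℕ.+ m
    open ModProperties (len ℓ)

  -- After `m` steps the position is `j + m` modulo `len ℓ`, and distinct positions carry distinct
  -- entries.
  u-period : ∀ ℓ i j → Period g (u ℓ i j) (len ℓ)
  u-period ℓ i j = record
    { nonZero = _
    ; returns = trans (fold-u ℓ i j (len ℓ))
                      (cong (u ℓ i) (trans (mod-cong (toℕ j ℕ.+ len ℓ) (toℕ j) ([m+n]%n≡m%n (toℕ j) (len ℓ))) (mod-toℕ j)))
    -- At a return `j + m` leaves remainder `j`; cancelling it exhibits `m` as the quotient times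
    -- `len ℓ`.
    ; minimal = λ m eq → divides ((toℕ j ℕ.+ m) / len ℓ) (ℕ.+-cancelˡ-≡ (toℕ j) _ _ (begin
        toℕ j ℕ.+ m
          ≡⟨ m≡m%n+[m/n]*n (toℕ j ℕ.+ m) (len ℓ) ⟩
        (toℕ j ℕ.+ m) % len ℓ ℕ.+ (toℕ j ℕ.+ m) / len ℓ ℕ.* len ℓ
          ≡⟨ cong (ℕ._+ (toℕ j ℕ.+ m) / len ℓ ℕ.* len ℓ) (remainder m eq) ⟩
        toℕ j ℕ.+ (toℕ j ℕ.+ m) / len ℓ ℕ.* len ℓ
          ∎))
    }
    where
    open ModProperties (len ℓ)
    remainder : ∀ m → fold (u ℓ i j) g m ≡ u ℓ i j → (toℕ j ℕ.+ m) % len ℓ ≡ toℕ j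
    remainder m eq = trans (sym (toℕ-mod (toℕ j ℕ.+ m)))
      (cong toℕ (distinctEntries ℓ i (trans (sym (fold-u ℓ i j m)) eq)))

  -- Entries of cycles of different lengths differ because they have different periods.
  u-injective : ∀ {ℓ i j ℓ′ i′ j′} → u ℓ i j ≡ u ℓ′ i′ j′ →
                _≡_ {A = Σ (Fin n) λ ℓ → Fin (k ℓ) × Fin (len ℓ)} (ℓ , i , j) (ℓ′ , i′ , j′)
  u-injective {ℓ} {i} {j} {ℓ′} {i′} {j′} eq
    with refl ← toℕ-injective (ℕ.suc-injective
                  (period-unique (u-period ℓ i j) (subst (λ a → Period g a (len ℓ′)) (sym eq) (u-period ℓ′ i′ j′))))
    with refl ← distinctCycles ℓ eq
    with refl ← distinctEntries ℓ i eq = refl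

module ConstructionProperties (p : ℕ) .{{_ : NonZero p}} {d t : ℕ}
  {g : LinearAlgebra.𝔽^ p t → LinearAlgebra.𝔽^ p t} (g-complete : IsCompleteMapping (LinearAlgebra._+_ p) g)
  {n : ℕ} {k : Fin n → ℕ} (E : CycleEnumeration g k)
  (M : (ℓ : Fin n) → Fin (k ℓ) → Fin (len ℓ) → LinearAlgebra.Matrix p d d)
  (M-CGL : ∀ ℓ i j → LinearAlgebra.CGL p (M ℓ i j))
  (w : (ℓ : Fin n) → Fin (k ℓ) → LinearAlgebra.𝔽^ p d)
  where

  open LinearAlgebra p
  open LinearAlgebraProperties p
  open CycleEnumeration E
  open CycleEnumerationProperties E
  open Construction E M w
  open ≡-Reasoning

  N : 𝔽^ t → Matrix d d
  N a = let ℓ , i , j = position a in M ℓ i j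

  N-CGL : ∀ a → CGL (N a)
  N-CGL a = let ℓ , i , j = position a in M-CGL ℓ i j

  a+ν≡g : ∀ a → a + ν a ≡ g a
  a+ν≡g a with ℓ , i , j , refl ← exhaustive a = trans (v+[w-v]≡w (u ℓ i j) _) (sym (step ℓ i j))

  -- In the coordinates of W ⊕ U, `f` is a skew product over `g`: the U-component moves by `g`, and
  -- the W-component by an affine map that depends on the coset only.
  f-++ : ∀ b a → f (b ++ a) ≡ affine (N a) (ω a) b ++ g a
  f-++ b a = begin
    F (take d (b ++ a)) (drop d (b ++ a))
      ≡⟨ cong₂ F (proj₁ split) (proj₂ split) ⟩
    (α a b ++ 𝟎) + (𝟎 ++ a) + (ω a ++ 𝟎) + (𝟎 ++ ν a)
      ≡⟨ cong (λ v → v + (ω a ++ 𝟎) + (𝟎 ++ ν a)) (zipWith-++ _+ᶠ_ (α a b) 𝟎 𝟎 a) ⟩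
    ((α a b + 𝟎) ++ (𝟎 + a)) + (ω a ++ 𝟎) + (𝟎 ++ ν a)
      ≡⟨ cong₂ (λ b a′ → (b ++ a′) + (ω a ++ 𝟎) + (𝟎 ++ ν a)) (+-identityʳ (α a b)) (+-identityˡ a) ⟩
    (α a b ++ a) + (ω a ++ 𝟎) + (𝟎 ++ ν a)
      ≡⟨ cong (_+ (𝟎 ++ ν a)) (zipWith-++ _+ᶠ_ (α a b) a (ω a) 𝟎) ⟩
    ((α a b + ω a) ++ (a + 𝟎)) + (𝟎 ++ ν a)
      ≡⟨ zipWith-++ _+ᶠ_ (α a b + ω a) (a + 𝟎) 𝟎 (ν a) ⟩
    (α a b + ω a + 𝟎) ++ (a + 𝟎 + ν a)
      ≡⟨ cong₂ _++_ (+-identityʳ (α a b + ω a)) (trans (cong (_+ ν a) (+-identityʳ a)) (a+ν≡g a)) ⟩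
    (α a b + ω a) ++ g a ∎
    where
    F : 𝔽^ d → 𝔽^ t → 𝔽^ (d ℕ.+ t)
    F b a = fromW (α a b) + fromU a + fromW (ω a) + fromU (ν a)
    split : take d (b ++ a) ≡ b × drop d (b ++ a) ≡ a
    split = ++-injective (take d (b ++ a)) b (take++drop≡id d (b ++ a))

  -- A view: matching on it replaces a vector by its two components, so that `f-++` applies.
  data Split : 𝔽^ (d ℕ.+ t) → Set where
    _⧺_ : (b : 𝔽^ d) (a : 𝔽^ t) → Split (b ++ a)

  split : ∀ v → Split v
  split v = subst Split (take++drop≡id d v) (take d v ⧺ drop d v)

  -- Moving along W keeps the U-component, so one matrix and one translation serve the whole coset;
  -- the constant term is the value of `f` at `v`.
  f-cosetwiseAffine : IsCosetwiseAffine d f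
  f-cosetwiseAffine v with split v
  ... | b ⧺ a = Vec.map (_++ 𝟎) (N a) , affine (N a) (ω a) b ++ g a , λ w → begin
    f ((w ++ 𝟎) + (b ++ a))                                     ≡⟨ cong f (zipWith-++ _+ᶠ_ w 𝟎 b a) ⟩
    f ((w + b) ++ (𝟎 + a))                                      ≡⟨ cong (λ a → f ((w + b) ++ a)) (+-identityˡ a) ⟩
    f ((w + b) ++ a)                                            ≡⟨ f-++ (w + b) a ⟩
    ((w + b) · N a + ω a) ++ g a                                ≡⟨ cong (λ v → (v + ω a) ++ g a) (·-distribʳ w b (N a)) ⟩
    (w · N a + b · N a + ω a) ++ g a                            ≡⟨ cong₂ _++_ (+-assoc (w · N a) (b · N a) (ω a)) (sym (+-identityˡ (g a))) ⟩
    (w · N a + affine (N a) (ω a) b) ++ (𝟎 + g a)               ≡⟨ zipWith-++ _+ᶠ_ (w · N a) 𝟎 (affine (N a) (ω a) b) (g a) ⟨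
    (w · N a ++ 𝟎) + (affine (N a) (ω a) b ++ g a)              ≡⟨ cong (_+ (affine (N a) (ω a) b ++ g a)) (·-map-++𝟎 t w (N a)) ⟨
    w · Vec.map (_++ 𝟎) (N a) + (affine (N a) (ω a) b ++ g a)   ∎

  -- The U-components agree because `g` is injective. Both points then lie in one coset, where the
  -- matrix is invertible.
  f-injective : Injective _≡_ _≡_ f
  f-injective {v} {v′} eq with split v | split v′
  ... | b ⧺ a | b′ ⧺ a′
    with eqˡ , eqʳ ← ++-injective (affine (N a) (ω a) b) _ (trans (sym (f-++ b a)) (trans eq (f-++ b′ a′)))
    with refl ← proj₁ (proj₁ g-complete) {a} {a′} eqʳ
    = cong (_++ a) (invertible⇒injective (proj₁ (N-CGL a)) (+-cancelʳ (ω a) eqˡ))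

  f+id-++ : ∀ b a → f (b ++ a) + (b ++ a) ≡ (b · N a + b + ω a) ++ (g a + a)
  f+id-++ b a = begin
    f (b ++ a) + (b ++ a)                          ≡⟨ cong (_+ (b ++ a)) (f-++ b a) ⟩
    (affine (N a) (ω a) b ++ g a) + (b ++ a)       ≡⟨ zipWith-++ _+ᶠ_ (affine (N a) (ω a) b) (g a) b a ⟩
    (b · N a + ω a + b) ++ (g a + a)               ≡⟨ cong (_++ (g a + a)) swapʳ ⟩
    (b · N a + b + ω a) ++ (g a + a)               ∎
    where
    swapʳ : b · N a + ω a + b ≡ b · N a + b + ω a
    swapʳ = trans (+-assoc (b · N a) (ω a) b) (trans (cong (b · N a +_) (+-comm (ω a) b)) (sym (+-assoc (b · N a) b (ω a))))

  -- The same argument with `g + id` on U; within a coset, the excluded eigenvalue -1 gives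
  -- injectivity.
  f+id-injective : Injective _≡_ _≡_ (λ v → f v + v)
  f+id-injective {v} {v′} eq with split v | split v′
  ... | b ⧺ a | b′ ⧺ a′
    with eqˡ , eqʳ ← ++-injective (b · N a + b + ω a) _ (trans (sym (f+id-++ b a)) (trans eq (f+id-++ b′ a′)))
    with refl ← proj₁ (proj₂ g-complete) {a} {a′} eqʳ
    = cong (_++ a) (noEigenvalue-1⇒injective (proj₂ (N-CGL a)) (+-cancelʳ (ω a) eqˡ))

  f-complete : IsCompleteMapping _+_ f
  f-complete = Cycles.injective⇒permutation V-finite f-injective , Cycles.injective⇒permutation V-finite f+id-injective
    where V-finite = 𝔽^-finite (d ℕ.+ t)

  -- Return of `f` to a coset of W

  f-u : ∀ ℓ i j b → f (b ++ u ℓ i j) ≡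
        affine (M ℓ i j) (if does (toℕ j ℕ.<? toℕ ℓ) then 𝟎 else w ℓ i) b ++ u ℓ i (suc (toℕ j) mod len ℓ)
  f-u ℓ i j b = trans (f-++ b (u ℓ i j)) (cong₂ _++_ (aux (u-injective (proj₂ (proj₂ (proj₂ (exhaustive (u ℓ i j))))))) (step ℓ i j))
    where
    -- `exhaustive` returns some position of this entry, and `u-injective` shows it to be
    -- `(ℓ , i , j)`. The equation of whole triples avoids transport between dependent components.
    aux : position (u ℓ i j) ≡ (ℓ , i , j) →
          affine (N (u ℓ i j)) (ω (u ℓ i j)) b ≡ affine (M ℓ i j) (if does (toℕ j ℕ.<? toℕ ℓ) then 𝟎 else w ℓ i) b
    aux eq = cong (λ { (ℓ , i , j) → affine (M ℓ i j) (if does (toℕ j ℕ.<? toℕ ℓ) then 𝟎 else w ℓ i) b }) eq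

  -- Stated for an arbitrary path `c` of cosets, so that the induction can drop its first vertex.
  -- The translation enters only at the last step, so no later matrix acts on `v`.
  fold-along-path : ∀ l (P : Fin (suc l) → Matrix d d) (c : Fin (suc l) → 𝔽^ t) v e →
                    (∀ j b → f (b ++ c (inject₁ j)) ≡ b · P (inject₁ j) ++ c (suc j)) →
                    (∀ b → f (b ++ c (fromℕ l)) ≡ affine (P (fromℕ l)) v b ++ e) →
                    ∀ b → fold (b ++ c zero) f (suc l) ≡ affine (matrixProduct P) v b ++ e
  fold-along-path zero    P c v e _ last b = trans (last b) (cong (λ a → (a + v) ++ e) (begin
    b · P zero            ≡⟨ ·-identity _ ⟨
    (b · P zero) · 𝟙      ≡⟨ ·-⊡ b (P zero) 𝟙 ⟨
    b · (P zero ⊡ 𝟙)      ∎))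
  fold-along-path (suc l) P c v e init last b = begin
    fold (b ++ c zero) f (suc (suc l))                           ≡⟨ fold-shift f (b ++ c zero) (suc l) ⟨
    fold (f (b ++ c zero)) f (suc l)                             ≡⟨ cong (λ v → fold v f (suc l)) (init zero b) ⟩
    fold (b · P zero ++ c (suc zero)) f (suc l)                  ≡⟨ fold-along-path l (P ∘ suc) (c ∘ suc) v e (init ∘ suc) last (b · P zero) ⟩
    affine (matrixProduct (P ∘ suc)) v (b · P zero) ++ e         ≡⟨ cong (λ a → (a + v) ++ e) (·-⊡ b (P zero) (matrixProduct (P ∘ suc))) ⟨
    affine (matrixProduct P) v b ++ e                            ∎

  -- The first-return map of `f` to the coset of `u ℓ i zero`, read on W; its cycle type is `γ ℓ i`.
  A : ∀ ℓ → Fin (k ℓ) → 𝔽^ d → 𝔽^ d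
  A ℓ i = affine (matrixProduct (M ℓ i)) (w ℓ i)

  f-return : ∀ ℓ i b → fold (b ++ u ℓ i zero) f (len ℓ) ≡ A ℓ i b ++ u ℓ i zero
  f-return ℓ i = fold-along-path (toℕ ℓ) (M ℓ i) (u ℓ i) (w ℓ i) (u ℓ i zero)
    -- Before the last entry the position is below `toℕ ℓ`, which is `len ℓ ∸ 1`: no translation and
    -- no wrap-around.
    (λ j b → trans (f-u ℓ i (inject₁ j) b) (cong₂ _++_
      (trans (cong (λ z → affine (M ℓ i (inject₁ j)) (if z then 𝟎 else w ℓ i) b)
                   (dec-true (_ ℕ.<? toℕ ℓ) (subst (ℕ._< toℕ ℓ) (sym (toℕ-inject₁ j)) (toℕ<n j))))
             (+-identityʳ _))
      (cong (u ℓ i) (trans (cong (λ s → suc s mod len ℓ) (toℕ-inject₁ j)) (L.mod-toℕ (suc j))))))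
    -- At the last entry the test fails, so `w ℓ i` is added, and the successor position wraps to 0.
    (λ b → trans (f-u ℓ i (fromℕ (toℕ ℓ)) b) (cong₂ _++_
      (cong (λ z → affine (M ℓ i (fromℕ (toℕ ℓ))) (if z then 𝟎 else w ℓ i) b)
            (dec-false (_ ℕ.<? toℕ ℓ) (ℕ.<-irrefl (toℕ-fromℕ (toℕ ℓ)))))
      (cong (u ℓ i) (trans (cong (λ s → suc s mod len ℓ) (toℕ-fromℕ (toℕ ℓ))) (L.mod-cong (len ℓ) 0 (n%n≡0 (len ℓ)))))))
    where module L = ModProperties (len ℓ)

  f-return-* : ∀ ℓ i b q → fold (b ++ u ℓ i zero) f (q ℕ.* len ℓ) ≡ fold b (A ℓ i) q ++ u ℓ i zero
  f-return-* ℓ i b zero    = refl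
  f-return-* ℓ i b (suc q) = begin
    fold v f (len ℓ ℕ.+ q ℕ.* len ℓ)                     ≡⟨ fold-+ v f (len ℓ) ⟩
    fold (fold v f (q ℕ.* len ℓ)) f (len ℓ)              ≡⟨ cong (λ v → fold v f (len ℓ)) (f-return-* ℓ i b q) ⟩
    fold (fold b (A ℓ i) q ++ u ℓ i zero) f (len ℓ)      ≡⟨ f-return ℓ i (fold b (A ℓ i) q) ⟩
    fold b (A ℓ i) (suc q) ++ u ℓ i zero                 ∎
    where v = b ++ u ℓ i zero

  fold-f-++ : ∀ b a m → ∃ λ b′ → fold (b ++ a) f m ≡ b′ ++ fold a g m
  fold-f-++ b a zero    = b , refl
  fold-f-++ b a (suc m) =
    let b′ , eq = fold-f-++ b a m in _ , trans (cong f eq) (f-++ b′ (fold a g m))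

  fold-f⇒fold-g : ∀ {b b′ a a′} m → fold (b ++ a) f m ≡ b′ ++ a′ → fold a g m ≡ a′
  fold-f⇒fold-g {b} {b′} {a} m eq = let c , eq′ = fold-f-++ b a m in ++-injectiveʳ c b′ (trans (sym eq′) eq)

  -- On U the orbit is that of `g`, which is back at `u ℓ i zero` only after multiples of `len ℓ`.
  f-return⁻ : ∀ ℓ i {b b′} m → fold (b ++ u ℓ i zero) f m ≡ b′ ++ u ℓ i zero →
              ∃ λ q → m ≡ q ℕ.* len ℓ × fold b (A ℓ i) q ≡ b′
  f-return⁻ ℓ i {b} {b′} m eq with divides q refl ← Period.minimal (u-period ℓ i zero) m (fold-f⇒fold-g {b} {b′} m eq) =
    q , refl , ++-injectiveˡ _ _ (trans (sym (f-return-* ℓ i b q)) eq)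

  -- Inherited from `f`, whose `len ℓ`-th power restricts to `A ℓ i` on the coset.
  A-injective : ∀ ℓ i → Injective _≡_ _≡_ (A ℓ i)
  A-injective ℓ i {b} {b′} eq = ++-injectiveˡ b b′ (fold-injective f-injective (len ℓ)
    (trans (f-return ℓ i b) (trans (cong (_++ u ℓ i zero) eq) (sym (f-return ℓ i b′)))))

  -- The return times of `f` at this point are `len ℓ` times those of `A ℓ i` at `b`.
  f-period : ∀ ℓ i {b c} → Period (A ℓ i) b c → Period f (b ++ u ℓ i zero) (len ℓ ℕ.* c)
  f-period ℓ i {b} {c} P = record
    { nonZero = ℕ.m*n≢0 (len ℓ) c {{_}} {{nonZero}}
    ; returns = begin
        fold (b ++ u ℓ i zero) f (len ℓ ℕ.* c)   ≡⟨ cong (fold (b ++ u ℓ i zero) f) (ℕ.*-comm (len ℓ) c) ⟩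
        fold (b ++ u ℓ i zero) f (c ℕ.* len ℓ)   ≡⟨ f-return-* ℓ i b c ⟩
        fold b (A ℓ i) c ++ u ℓ i zero           ≡⟨ cong (_++ u ℓ i zero) returns ⟩
        b ++ u ℓ i zero                          ∎
    ; minimal = λ m eq → let q , m≡ , eq′ = f-return⁻ ℓ i m eq in
        subst (len ℓ ℕ.* c ∣_) (trans (ℕ.*-comm (len ℓ) q) (sym m≡)) (*-monoʳ-∣ (len ℓ) (minimal q eq′))
    }
    where open Period P

  -- A transversal of the cycles of `f`, and the cycle type

  W-finite = 𝔽^-finite d
  V-finite = 𝔽^-finite (d ℕ.+ t)

  module CA ℓ i = Cycles W-finite (A-injective ℓ i)
  module Cf = Cycles V-finite f-injective

  fibre : ∀ ℓ → Fin (k ℓ) → List (𝔽^ (d ℕ.+ t))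
  fibre ℓ i = map (_++ u ℓ i zero) (cycles W-finite (A ℓ i))

  transversal : List (𝔽^ (d ℕ.+ t))
  transversal = concat (List.tabulate λ ℓ → concat (List.tabulate (fibre ℓ)))

  -- Projected to U, the path from `v` to `v′` is a `g`-orbit, which never leaves the cycle
  -- `(ℓ , i)`.
  ∼⇒same-cycle-of-g : ∀ {ℓ i ℓ′ i′ v v′} → v ∈ fibre ℓ i → v′ ∈ fibre ℓ′ i′ → v Cf.∼ v′ →
                      _≡_ {A = Σ (Fin n) (Fin ∘ k)} (ℓ , i) (ℓ′ , i′)
  ∼⇒same-cycle-of-g {ℓ} {i} v∈ v′∈ v∼v′
    with b , _ , refl ← ∈-map⁻ _ v∈ | b′ , _ , refl ← ∈-map⁻ _ v′∈ | m , eq ← Cf.∼⁻ v∼v′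
    = cong (λ { (ℓ , i , _) → ℓ , i }) (u-injective (trans (sym (fold-u ℓ i zero m)) (fold-f⇒fold-g {b} {b′} m eq)))

  ∈-fibres⁻ : ∀ {ℓ v} → v ∈ concat (List.tabulate (fibre ℓ)) → ∃ λ i → v ∈ fibre ℓ i
  ∈-fibres⁻ {ℓ} v∈ = Any.tabulate⁻ (∈-concat⁻ (List.tabulate (fibre ℓ)) v∈)

  transversal-distinct : AllPairs (λ v v′ → ¬ v Cf.∼ v′) transversal
  transversal-distinct = AllPairs.concat⁺
    (All.tabulate⁺ λ ℓ → AllPairs.concat⁺
      (All.tabulate⁺ λ i → AllPairs.map⁺ (AllPairs.map
        -- Within one fibre, a path of `f` between two representatives is a path of `A ℓ i`, between
        -- which cycles are already distinct.
        (λ b≁b′ v∼v′ → let m , eq = Cf.∼⁻ v∼v′ ; q , _ , eq′ = f-return⁻ ℓ i m eq in b≁b′ (CA.∼⁺ ℓ i q eq′))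
        (proj₁ (CA.cycles-transversal ℓ i))))
      (AllPairs.tabulate⁺ λ i≢i′ → All.tabulate λ v∈ → All.tabulate λ v′∈ v∼v′ →
        contradiction (∼⇒same-cycle-of-g v∈ v′∈ v∼v′) λ { refl → i≢i′ refl }))
    (AllPairs.tabulate⁺ λ ℓ≢ℓ′ → All.tabulate λ v∈ → All.tabulate λ v′∈ v∼v′ →
      ℓ≢ℓ′ (cong proj₁ (∼⇒same-cycle-of-g (proj₂ (∈-fibres⁻ v∈)) (proj₂ (∈-fibres⁻ v′∈)) v∼v′)))

  -- From entry `j`, the remaining `len ℓ ∸ j` steps lead to entry 0; for `j` zero this is a full
  -- turn.
  reach-fibre : ∀ v → ∃ λ ℓ → ∃₂ λ i b → v Cf.∼ (b ++ u ℓ i zero)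
  reach-fibre v with split v
  ... | b ⧺ a with ℓ , i , j , refl ← exhaustive a =
    let m = len ℓ ∸ toℕ j
        b′ , eq = fold-f-++ b (u ℓ i j) m
    in ℓ , i , b′ , Cf.∼⁺ m (trans eq (cong (b′ ++_) (begin
      fold (u ℓ i j) g m                   ≡⟨ fold-u ℓ i j m ⟩
      u ℓ i ((toℕ j ℕ.+ m) mod len ℓ)      ≡⟨ cong (λ s → u ℓ i (s mod len ℓ)) (ℕ.m+[n∸m]≡n (ℕ.<⇒≤ (toℕ<n j))) ⟩
      u ℓ i (len ℓ mod len ℓ)              ≡⟨ cong (u ℓ i) (ModProperties.mod-cong (len ℓ) (len ℓ) 0 (n%n≡0 (len ℓ))) ⟩
      u ℓ i zero                           ∎)))

  transversal-complete : ∀ v → Any (v Cf.∼_) transversal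
  transversal-complete v with ℓ , i , b , v∼b ← reach-fibre v =
    Any.concat⁺ (Any.tabulate⁺ ℓ (Any.concat⁺ (Any.tabulate⁺ i (Any.map⁺ (Any.map
      -- Once over entry 0, turns of length `len ℓ` follow the orbit of `A ℓ i` to the
      -- representative `c`.
      (λ {c} b∼c → let q , eq = CA.∼⁻ ℓ i b∼c in
        Cf.∼-trans v∼b (Cf.∼⁺ (q ℕ.* len ℓ) (trans (f-return-* ℓ i b q) (cong (_++ u ℓ i zero) eq))))
      (proj₂ (CA.cycles-transversal ℓ i) b))))))

  fibre-cycleLength : ∀ ℓ i b → NonZero (cycleLength W-finite (A ℓ i) b) ×
                      cycleLength V-finite f (b ++ u ℓ i zero) ≡ len ℓ ℕ.* cycleLength W-finite (A ℓ i) b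
  fibre-cycleLength ℓ i b = Period.nonZero P , Cf.period⇒cycleLength (f-period ℓ i P)
    where P = CA.cycleLength-period ℓ i b

  -- Every cycle of `A ℓ i` gives a cycle of `f` that is `len ℓ` times as long, which is the
  -- substitution made by `BU (len ℓ)`.
  fibre-product : ∀ ℓ i → ∏ˡ (map (X ∘ cycleLength V-finite f) (fibre ℓ i)) ≈ BU (len ℓ) (γ ℓ i)
  fibre-product ℓ i = ≈-sym (BU-∏ˡ (len ℓ) {q = γ ℓ i}
    (cycleLength W-finite (A ℓ i)) (cycleLength V-finite f) (_++ u ℓ i zero) (cycles W-finite (A ℓ i))
    (CA.CT-transversal ℓ i (CA.cycles-transversal ℓ i))
    (All.universal (fibre-cycleLength ℓ i) (cycles W-finite (A ℓ i))))

  f-cycleType : CT V-finite f ≈ ∏ (λ ℓ → ∏ (λ i → BU (len ℓ) (γ ℓ i)))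
  f-cycleType =
    -- The nested concatenation in `transversal` turns the product over representatives into a
    -- double product over `ℓ` and `i`.
    ≈-trans (Cf.CT-transversal (transversal-distinct , transversal-complete))
    (≈-trans (∏ˡ-concat-tabulate h λ ℓ → concat (List.tabulate (fibre ℓ)))
    (∏-cong λ ℓ → ≈-trans (∏ˡ-concat-tabulate h (fibre ℓ)) (∏-cong (fibre-product ℓ))))
    where h = X ∘ cycleLength V-finite f

theorem4p5 : (p : ℕ) .{{_ : NonZero p}} → Prime p →
    (d t : ℕ) .{{_ : NonZero d}} .{{_ : NonZero t}} →
    let open LinearAlgebra p in
    (g : 𝔽^ t → 𝔽^ t) → IsCompleteMapping _+_ g →
    (k : Fin (p ℕ.^ t) → ℕ) → CT (𝔽^-finite t) g ≈ monomial k →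
    (E : CycleEnumeration g k)
    (M : (ℓ : Fin (p ℕ.^ t)) → Fin (k ℓ) → Fin (len ℓ) → Matrix d d) →
    (∀ ℓ i j → CGL (M ℓ i j)) →
    (w : (ℓ : Fin (p ℕ.^ t)) → Fin (k ℓ) → 𝔽^ d) →
    let open Construction E M w in
    IsCosetwiseAffine d f
    × IsCompleteMapping _+_ f
    × CT (𝔽^-finite (d ℕ.+ t)) f ≈ ∏ (λ ℓ → ∏ (λ i → BU (len ℓ) (γ ℓ i)))
theorem4p5 p _ d t g g-complete k _ E M M-CGL w = f-cosetwiseAffine , f-complete , f-cycleType
  where open ConstructionProperties p g-complete E M M-CGL w
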